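{- The sequences $(\omega(n))_{n\geq 1}$ and $(\Omega(n))_{n\geq 1}$ are not $k$-regular for any integer $k\geq 2$, where $\omega(n)$ is the number of distinct prime divisors of $n$ and $\Omega(n)$ the number of prime divisors of $n$ counted with multiplicity.
   Context: An integer sequence $(s(n))$ is $k$-regular if its $k$-kernel $\{(s(k^l n+r))_{n}: l\geq 0,\ 0\leq r<k^l\}$ is contained in the $\mathbb{Z}$-linear span of finitely many integer sequences. -}

module Defs where

open import Data.Nat using (ℕ; zero; suc; _+_; _*_; _^_; _<_; _≤_)
open import Data.Nat.Divisibility using (_∣_; _∣?_)
open import Data.Nat.Primality using (Prime; prime?)
open import Data.Integer using (ℤ; +_)
import Data.Integer as ℤ
open import Data.List using (List; length; filter; map; upTo; drop)
open import Data.Nat.ListAction using (sum)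
open import Data.Fin using (Fin)
open import Data.Product using (Σ; ∃; _×_)
open import Relation.Binary.PropositionalEquality using (_≡_)
open import Relation.Nullary.Decidable using (_×-dec_)

range1 : ℕ → List ℕ
range1 n = drop 1 (upTo (suc n))

-- primes p with p ≤ n and p ∣ n  (for n ≥ 1 these are all prime divisors of n)
primeDivisors : ℕ → List ℕ
primeDivisors n = filter (λ p → prime? p ×-dec (p ∣? n)) (range1 n)

ω : ℕ → ℕ
ω n = length (primeDivisors n)

-- p-adic valuation of n ≥ 1: number of e ∈ [1..n] with p^e ∣ n
-- (for n ≥ 1 and p ≥ 2 this is the largest e with p^e ∣ n, since p^e ∣ n forces e ≤ n)
val : ℕ → ℕ → ℕ
val p n = length (filter (λ e → (p ^ e) ∣? n) (range1 n))

Ω : ℕ → ℕ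
Ω n = sum (map (λ p → val p n) (primeDivisors n))

-- Integer sequences indexed by n ≥ 1, represented as functions ℕ → ℤ
-- (only values at positive arguments are ever used).
-- Kernel element for l, r: the sequence n ↦ s(k^l n + r), n ≥ 1,
-- encoded as a function of m = n - 1.
kernelSeq : (k : ℕ) → (ℕ → ℤ) → ℕ → ℕ → (ℕ → ℤ)
kernelSeq k s l r m = s (k ^ l * suc m + r)

linComb : (d : ℕ) → (Fin d → ℤ) → (Fin d → ℕ → ℤ) → ℕ → ℤ
linComb zero c f m = + 0
linComb (suc d) c f m = c Fin.zero ℤ.* f Fin.zero m ℤ.+ linComb d (λ i → c (Fin.suc i)) (λ i → f (Fin.suc i)) m
  where import Data.Fin as Fin

-- s (indexed by n ≥ 1) is k-regular: its k-kernel lies in the ℤ-span of finitely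
-- many integer sequences (also indexed by n ≥ 1).
IsRegular : ℕ → (ℕ → ℤ) → Set
IsRegular k s =
  Σ ℕ λ d → Σ (Fin d → ℕ → ℤ) λ f →
    ∀ (l r : ℕ) → r < k ^ l →
      Σ (Fin d → ℤ) λ c → ∀ (m : ℕ) → kernelSeq k s l r m ≡ linComb d c f m

ωSeq : ℕ → ℤ
ωSeq n = + ω n

ΩSeq : ℕ → ℤ
ΩSeq n = + Ω n

{-# OPTIONS --safe #-}

-- If s ∈ {ω, Ω} were k-regular with d sequences spanning the kernel, the d + 1 kernel sequences
-- s(Kn + i), 1 ≤ i ≤ d + 1, K = kˡ, would satisfy a nontrivial integer relation. This is impossible,
-- since for any H and i₀ some n makes ω(Kn + i₀) exceed H · Ω(Kn + i) for all other i.
-- To find n, let P be a product of T primes from (K + d + 2, 2ʲ] and choose a with P ∣ Ka + i₀, so that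
-- ω(Kn + i₀) ≥ T for n = a + Pm. Averaging over m ≤ M = 4ˢ, the primes up to 2ˢ contribute O(s) to
-- Ω(Kn + i), because they divide it with frequency 1/p and the harmonic sum up to 2ˢ is O(s). The
-- primes above 2ˢ contribute at most log₂(Kn + i) / s = O(s + jT/s). With s = 4Gj and T = 32G²j, where
-- G bounds H times the number of indices, both are below T/G once j is large. Such a T is
-- available because π(2ʲ) is not O(j).

module Submission where

open import Defs
open import Data.Bool using (true; false; if_then_else_)
open import Data.Empty using (⊥)
open import Data.Fin using (Fin; zero; suc; toℕ; punchIn)
open import Data.Fin.Properties using (any?; punchInᵢ≢i; toℕ<n; toℕ-injective)
open import Data.Integer using (ℤ; 0ℤ; 1ℤ; ∣_∣)
import Data.Integer as ℤ
import Data.Integer.Properties as ℤ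
import Data.Integer.Tactic.RingSolver as ℤ-Solver
open import Data.List using (List; []; _∷_; _++_; length; filter; map)
open import Data.List.Properties using (applyUpTo-∷ʳ; filter-++; map-++)
import Data.List.Relation.Unary.All as All
open import Data.Nat
open import Data.Nat.Coprimality using (Coprime; coprime-Bézout)
open import Data.Nat.Divisibility
open import Data.Nat.DivMod using (_/_; _%_; m≡m%n+[m/n]*n; m%n<n)
open import Data.Nat.GCD using (module Bézout)
open import Data.Nat.ListAction using (sum)
open import Data.Nat.ListAction.Properties using (sum-++)
open import Data.Nat.Primality
open import Data.Nat.Primality.Factorisation using (factorise; PrimeFactorisation)
open import Data.Nat.Properties
open import Data.Nat.Tactic.RingSolver using (solve-∀)
open import Data.Product using (Σ; ∃-syntax; _×_; _,_; proj₁; proj₂)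
open import Data.Sum using (_⊎_; inj₁; inj₂)
open import Data.Vec.Functional using (insertAt)
open import Data.Vec.Functional.Properties using (insertAt-lookup; insertAt-punchIn)
open import Function using (_∘_; case_of_)
open import Relation.Binary.PropositionalEquality
open import Relation.Nullary using (¬_; Dec; yes; no; does; contradiction)
open import Relation.Nullary.Decidable using (_×-dec_; ¬?; dec-true; dec-false; decidable-stable)
open import Algebra.Properties.AbelianGroup ℤ.+-0-abelianGroup using (inverseˡ-unique)
open import Algebra.Properties.CommutativeMonoid.Sum ℤ.+-0-commutativeMonoid
  using (sum-cong-≗; sum-remove; ∑-distrib-+) renaming (sum to ℤ-sum)
open import Algebra.Properties.Semiring.Sum ℤ.+-*-semiring
  using () renaming (*-distribˡ-sum to ℤ-*-distribˡ-sum)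
open import Algebra.Properties.Semiring.Sum +-*-semiring
  using () renaming (sum to ℕ-sum; *-distribˡ-sum to ℕ-*-distribˡ-sum; *-distribʳ-sum to ℕ-*-distribʳ-sum)

-- Sums over 1 ≤ i ≤ n

∑ : ℕ → (ℕ → ℕ) → ℕ
∑ zero    f = 0
∑ (suc n) f = ∑ n f + f (suc n)

∑-mono-≤ : ∀ n {f g : ℕ → ℕ} → (∀ i → 1 ≤ i → i ≤ n → f i ≤ g i) → ∑ n f ≤ ∑ n g
∑-mono-≤ zero    f≤g = z≤n
∑-mono-≤ (suc n) f≤g =
  +-mono-≤ (∑-mono-≤ n λ i 1≤i i≤n → f≤g i 1≤i (m≤n⇒m≤1+n i≤n)) (f≤g (suc n) (s≤s z≤n) ≤-refl)

∑-cong : ∀ n {f g : ℕ → ℕ} → (∀ i → f i ≡ g i) → ∑ n f ≡ ∑ n g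
∑-cong zero    f≡g = refl
∑-cong (suc n) f≡g = cong₂ _+_ (∑-cong n f≡g) (f≡g (suc n))

∑-monoˡ-≤ : ∀ f {m n} → m ≤ n → ∑ m f ≤ ∑ n f
∑-monoˡ-≤ f {m} {zero}  m≤n rewrite n≤0⇒n≡0 m≤n = z≤n
∑-monoˡ-≤ f {m} {suc n} m≤n with m ≟ suc n
... | yes refl = ≤-refl
... | no  m≢   = ≤-trans (∑-monoˡ-≤ f (s≤s⁻¹ (≤∧≢⇒< m≤n m≢))) (m≤m+n _ _)

term≤∑ : ∀ f {i n} → 1 ≤ i → i ≤ n → f i ≤ ∑ n f
term≤∑ f {suc i} 1≤i i≤n = ≤-trans (m≤n+m _ (∑ i f)) (∑-monoˡ-≤ f i≤n)

∑-+ : ∀ n (f g : ℕ → ℕ) → ∑ n (λ i → f i + g i) ≡ ∑ n f + ∑ n g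
∑-+ zero    f g = refl
∑-+ (suc n) f g rewrite ∑-+ n f g = lemma (∑ n f) (∑ n g) (f (suc n)) (g (suc n))
  where
  lemma : ∀ a b c d → a + b + (c + d) ≡ a + c + (b + d)
  lemma = solve-∀

∑-*ˡ : ∀ n c (f : ℕ → ℕ) → ∑ n (λ i → c * f i) ≡ c * ∑ n f
∑-*ˡ zero    c f = sym (*-zeroʳ c)
∑-*ˡ (suc n) c f rewrite ∑-*ˡ n c f = sym (*-distribˡ-+ c (∑ n f) (f (suc n)))

∑-const : ∀ n c → ∑ n (λ _ → c) ≡ n * c
∑-const zero    c = refl
∑-const (suc n) c rewrite ∑-const n c = +-comm (n * c) c

∑-zero : ∀ n {f : ℕ → ℕ} → (∀ i → 1 ≤ i → i ≤ n → f i ≡ 0) → ∑ n f ≡ 0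
∑-zero n f≡0 = n≤0⇒n≡0 (≤-trans (∑-mono-≤ n (λ i p q → ≤-reflexive (f≡0 i p q)))
                                (≤-reflexive (trans (∑-const n 0) (*-zeroʳ n))))

∑-swap : ∀ m n (f : ℕ → ℕ → ℕ) → ∑ m (λ i → ∑ n (f i)) ≡ ∑ n (λ j → ∑ m (λ i → f i j))
∑-swap zero    n f = sym (∑-zero n λ _ _ _ → refl)
∑-swap (suc m) n f rewrite ∑-swap m n f = sym (∑-+ n (λ j → ∑ m (λ i → f i j)) (f (suc m)))

-- If the last term exceeds `B`, dropping it keeps the average of the others at most `B`, so the
-- search continues downwards; a single remaining term is itself the average.
∑-pigeonhole : ∀ M B (f : ℕ → ℕ) → ∑ (suc M) f ≤ suc M * B → ∃[ m ] 1 ≤ m × f m ≤ B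
∑-pigeonhole zero    B f ∑≤ = 1 , s≤s z≤n , ≤-trans ∑≤ (≤-reflexive (+-identityʳ B))
∑-pigeonhole (suc M) B f ∑≤ with f (suc (suc M)) ≤? B
... | yes f≤B = suc (suc M) , s≤s z≤n , f≤B
... | no  f≰B = ∑-pigeonhole M B f (+-cancelʳ-≤ B _ _ (begin
  ∑ (suc M) f + B               ≤⟨ +-monoʳ-≤ _ (<⇒≤ (≰⇒> f≰B)) ⟩
  ∑ (suc M) f + f (suc (suc M)) ≤⟨ ∑≤ ⟩
  B + suc M * B                 ≡⟨ +-comm B _ ⟩
  suc M * B + B                 ∎))
  where open ≤-Reasoning

-- Indicators, and list counts as sums

𝟙 : ∀ {a} {A : Set a} → Dec A → ℕ
𝟙 A? = if does A? then 1 else 0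

𝟙-yes : ∀ {a} {A : Set a} (A? : Dec A) → A → 𝟙 A? ≡ 1
𝟙-yes A? x rewrite dec-true A? x = refl

𝟙-no : ∀ {a} {A : Set a} (A? : Dec A) → ¬ A → 𝟙 A? ≡ 0
𝟙-no A? ¬x rewrite dec-false A? ¬x = refl

𝟙≤1 : ∀ {a} {A : Set a} (A? : Dec A) → 𝟙 A? ≤ 1
𝟙≤1 A? with does A?
... | true  = ≤-refl
... | false = z≤n

𝟙-mono : ∀ {a b} {A : Set a} {B : Set b} (A? : Dec A) (B? : Dec B) → (A → B) → 𝟙 A? ≤ 𝟙 B?
𝟙-mono (no _)  B? A⇒B = z≤n
𝟙-mono (yes x) B? A⇒B rewrite 𝟙-yes B? (A⇒B x) = ≤-refl

sum-filter-∷ʳ : ∀ {P : ℕ → Set} (P? : ∀ i → Dec (P i)) (f : ℕ → ℕ) xs y →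
  sum (map f (filter P? (xs ++ y ∷ []))) ≡ sum (map f (filter P? xs)) + 𝟙 (P? y) * f y
sum-filter-∷ʳ P? f xs y = begin
  sum (map f (filter P? (xs ++ y ∷ [])))
    ≡⟨ cong (sum ∘ map f) (filter-++ P? xs (y ∷ [])) ⟩
  sum (map f (filter P? xs ++ filter P? (y ∷ [])))
    ≡⟨ cong sum (map-++ f (filter P? xs) _) ⟩
  sum (map f (filter P? xs) ++ map f (filter P? (y ∷ [])))
    ≡⟨ sum-++ (map f (filter P? xs)) _ ⟩
  sum (map f (filter P? xs)) + sum (map f (filter P? (y ∷ [])))
    ≡⟨ cong (sum (map f (filter P? xs)) +_) last ⟩
  sum (map f (filter P? xs)) + 𝟙 (P? y) * f y ∎
  where
  open ≡-Reasoning
  last : sum (map f (filter P? (y ∷ []))) ≡ 𝟙 (P? y) * f y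
  last with does (P? y)
  ... | true  = refl
  ... | false = refl

sum-filter-range1 : ∀ {P : ℕ → Set} (P? : ∀ i → Dec (P i)) (f : ℕ → ℕ) n →
  sum (map f (filter P? (range1 n))) ≡ ∑ n (λ i → 𝟙 (P? i) * f i)
sum-filter-range1 P? f zero    = refl
sum-filter-range1 P? f (suc n) = begin
  sum (map f (filter P? (range1 (suc n))))
    ≡⟨ cong (sum ∘ map f ∘ filter P?) (applyUpTo-∷ʳ suc n) ⟨
  sum (map f (filter P? (range1 n ++ suc n ∷ [])))
    ≡⟨ sum-filter-∷ʳ P? f (range1 n) (suc n) ⟩
  sum (map f (filter P? (range1 n))) + 𝟙 (P? (suc n)) * f (suc n)
    ≡⟨ cong (_+ 𝟙 (P? (suc n)) * f (suc n)) (sum-filter-range1 P? f n) ⟩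
  ∑ (suc n) (λ i → 𝟙 (P? i) * f i) ∎
  where open ≡-Reasoning

length≡sum-ones : ∀ (xs : List ℕ) → length xs ≡ sum (map (λ _ → 1) xs)
length≡sum-ones []       = refl
length≡sum-ones (x ∷ xs) = cong suc (length≡sum-ones xs)

length-filter-range1 : ∀ {P : ℕ → Set} (P? : ∀ i → Dec (P i)) n →
  length (filter P? (range1 n)) ≡ ∑ n (λ i → 𝟙 (P? i))
length-filter-range1 P? n = begin
  length (filter P? (range1 n))                ≡⟨ length≡sum-ones (filter P? (range1 n)) ⟩
  sum (map (λ _ → 1) (filter P? (range1 n)))   ≡⟨ sum-filter-range1 P? (λ _ → 1) n ⟩
  ∑ n (λ i → 𝟙 (P? i) * 1)                     ≡⟨ ∑-cong n (λ i → *-identityʳ _) ⟩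
  ∑ n (λ i → 𝟙 (P? i))                         ∎
  where open ≡-Reasoning

ω≡∑ : ∀ n → ω n ≡ ∑ n (λ p → 𝟙 (prime? p ×-dec (p ∣? n)))
ω≡∑ n = length-filter-range1 _ n

Ω≡∑ : ∀ n → Ω n ≡ ∑ n (λ p → 𝟙 (prime? p ×-dec (p ∣? n)) * val p n)
Ω≡∑ n = sum-filter-range1 _ _ n

val≡∑ : ∀ p n → val p n ≡ ∑ n (λ e → 𝟙 ((p ^ e) ∣? n))
val≡∑ p n = length-filter-range1 _ n

-- Valuations and products of prime powers

prime>1 : ∀ {p} → Prime p → 1 < p
prime>1 {p} pp = nonTrivial⇒n>1 p ⦃ prime⇒nonTrivial pp ⦄

downward-≤ : ∀ {P : ℕ → Set} → (∀ e → P (suc e) → P e) → ∀ {m n} → m ≤ n → P n → P m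
downward-≤ down {m} {zero}  m≤n x rewrite n≤0⇒n≡0 m≤n = x
downward-≤ down {m} {suc n} m≤n x with m ≟ suc n
... | yes refl = x
... | no  m≢   = downward-≤ down (s≤s⁻¹ (≤∧≢⇒< m≤n m≢)) (down n x)

∑-𝟙-all : ∀ {P : ℕ → Set} (P? : ∀ i → Dec (P i)) n →
  (∀ i → i ≤ n → P i) → ∑ n (λ i → 𝟙 (P? i)) ≡ n
∑-𝟙-all P? zero    all = refl
∑-𝟙-all P? (suc n) all
  rewrite ∑-𝟙-all P? n (λ i i≤n → all i (m≤n⇒m≤1+n i≤n)) | 𝟙-yes (P? (suc n)) (all (suc n) ≤-refl)
  = +-comm n 1

-- For a downward closed `P`, the number of indices in [1..n] satisfying it is the largest such
-- index, or 0. With `P e` read as `p ^ e ∣ n`, this turns the count that defines `val` into an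
-- exponent.
∑-𝟙-downward : ∀ {P : ℕ → Set} (P? : ∀ i → Dec (P i)) → P 0 → (∀ e → P (suc e) → P e) →
  ∀ n → P (∑ n (λ i → 𝟙 (P? i)))
∑-𝟙-downward P? p₀ down zero    = p₀
∑-𝟙-downward {P} P? p₀ down (suc n) = case P? (suc n) of λ where
  (yes x) → subst P (sym (∑-𝟙-all P? (suc n) λ i i≤n → downward-≤ {P} down i≤n x)) x
  (no ¬x) → subst P (sym (trans (cong (∑ n (λ i → 𝟙 (P? i)) +_) (𝟙-no (P? (suc n)) ¬x)) (+-identityʳ _)))
                    (∑-𝟙-downward P? p₀ down n)

^-∣-downward : ∀ p n e → p ^ suc e ∣ n → p ^ e ∣ n
^-∣-downward p n e = m*n∣⇒n∣ p (p ^ e)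

p^val∣n : ∀ p n → p ^ val p n ∣ n
p^val∣n p n = subst (λ v → p ^ v ∣ n) (sym (val≡∑ p n))
  (∑-𝟙-downward (λ e → (p ^ e) ∣? n) (1∣ n) (^-∣-downward p n) n)

∤⇒val< : ∀ p n l → ¬ (p ^ l ∣ n) → val p n < l
∤⇒val< p n l p^l∤n = ≰⇒> λ l≤v →
  p^l∤n (downward-≤ {λ e → p ^ e ∣ n} (^-∣-downward p n) l≤v (p^val∣n p n))

∣⇒1≤val : ∀ p n → 1 ≤ n → p ∣ n → 1 ≤ val p n
∣⇒1≤val p n 1≤n p∣n = subst₂ _≤_
  (𝟙-yes ((p ^ 1) ∣? n) (subst (_∣ n) (sym (^-identityʳ p)) p∣n)) (sym (val≡∑ p n))
  (term≤∑ (λ e → 𝟙 ((p ^ e) ∣? n)) ≤-refl 1≤n)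

-- A range of exponents independent of `n` can later be exchanged with a sum over a progression. It
-- is long enough because `2 ^ val p n ≤ p ^ val p n ≤ n < 2 ^ E`.
val≤∑ : ∀ {p n E} → 2 ≤ p → 1 ≤ n → n < 2 ^ E → val p n ≤ ∑ E (λ e → 𝟙 ((p ^ e) ∣? n))
val≤∑ {p} {n} {E} 2≤p 1≤n n<2^E = begin
  v                            ≡⟨ ∑-𝟙-all (λ e → (p ^ e) ∣? n) v
                                    (λ e e≤v → downward-≤ {λ e → p ^ e ∣ n} (^-∣-downward p n) e≤v (p^val∣n p n)) ⟨
  ∑ v (λ e → 𝟙 ((p ^ e) ∣? n)) ≤⟨ ∑-monoˡ-≤ _ v≤E ⟩
  ∑ E (λ e → 𝟙 ((p ^ e) ∣? n)) ∎
  where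
  open ≤-Reasoning
  v : ℕ
  v = val p n
  v≤E : v ≤ E
  v≤E = ≮⇒≥ λ E<v → <-irrefl refl (begin-strict
    n     <⟨ n<2^E ⟩
    2 ^ E ≤⟨ ^-monoʳ-≤ 2 (<⇒≤ E<v) ⟩
    2 ^ v ≤⟨ ^-monoˡ-≤ v 2≤p ⟩
    p ^ v ≤⟨ ∣⇒≤ ⦃ >-nonZero 1≤n ⦄ (p^val∣n p n) ⟩
    n     ∎)

ω≤Ω : ∀ n → ω n ≤ Ω n
ω≤Ω n = subst₂ _≤_ (sym (ω≡∑ n)) (sym (Ω≡∑ n)) (∑-mono-≤ n step)
  where
  step : ∀ p → 1 ≤ p → p ≤ n →
    𝟙 (prime? p ×-dec (p ∣? n)) ≤ 𝟙 (prime? p ×-dec (p ∣? n)) * val p n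
  step p 1≤p p≤n = case prime? p ×-dec (p ∣? n) of λ where
    (yes x) → subst (λ c → c ≤ c * val p n) (sym (𝟙-yes (prime? p ×-dec (p ∣? n)) x))
                (≤-trans (∣⇒1≤val p n (≤-trans 1≤p p≤n) (proj₂ x)) (≤-reflexive (sym (*-identityˡ _))))
    (no ¬x) → ≤-trans (≤-reflexive (𝟙-no (prime? p ×-dec (p ∣? n)) ¬x)) z≤n

-- The number with exponent function `v`. It serves both for the product of the primes in a window
-- (`v = χ w`) and for the part of a number composed of its large primes.
∏^ : ℕ → (ℕ → ℕ) → ℕ
∏^ zero    v = 1
∏^ (suc n) v = ∏^ n v * suc n ^ v (suc n)

SupportedOnPrimes : (ℕ → ℕ) → Set
SupportedOnPrimes v = ∀ p → v p ≡ 0 ⊎ Prime p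

prime∣^⇒∣ : ∀ {p} → Prime p → ∀ m e → p ∣ m ^ e → p ∣ m
prime∣^⇒∣ pp m zero    p∣1 = contradiction (∣1⇒≡1 p∣1) (≢-sym (<⇒≢ (prime>1 pp)))
prime∣^⇒∣ pp m (suc e) p∣ with euclidsLemma m (m ^ e) pp p∣
... | inj₁ p∣m  = p∣m
... | inj₂ p∣m^ = prime∣^⇒∣ pp m e p∣m^

prime∣∏^⇒ : ∀ {q} → Prime q → ∀ n v → SupportedOnPrimes v → q ∣ ∏^ n v → q ≤ n × v q ≢ 0
prime∣∏^⇒ pq zero    v sup q∣ = contradiction (∣1⇒≡1 q∣) (≢-sym (<⇒≢ (prime>1 pq)))
prime∣∏^⇒ {q} pq (suc n) v sup q∣ with euclidsLemma (∏^ n v) _ pq q∣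
... | inj₁ q∣Π = let q≤n , vq≢0 = prime∣∏^⇒ pq n v sup q∣Π in m≤n⇒m≤1+n q≤n , vq≢0
... | inj₂ q∣^ with prime∣^⇒∣ pq (suc n) (v (suc n)) q∣^
...   | q∣sn with sup (suc n)
...     | inj₁ v≡0 = contradiction (∣1⇒≡1 (subst (λ e → q ∣ suc n ^ e) v≡0 q∣^)) (≢-sym (<⇒≢ (prime>1 pq)))
...     | inj₂ psn with prime⇒irreducible psn q∣sn
...       | inj₁ q≡1  = contradiction q≡1 (≢-sym (<⇒≢ (prime>1 pq)))
...       | inj₂ refl = ≤-refl , λ v≡0 →
            contradiction (∣1⇒≡1 (subst (λ e → q ∣ suc n ^ e) v≡0 q∣^)) (≢-sym (<⇒≢ (prime>1 pq)))

-- Induction on `b`: once u = u′ q^b, cancelling q^b leaves q ∣ y u′, and Euclid's lemma gives the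
-- last factor `q` to u′.
^-∣-cancelˡ : ∀ {q} → Prime q → ∀ {y} → ¬ (q ∣ y) → ∀ b {u} → q ^ b ∣ y * u → q ^ b ∣ u
^-∣-cancelˡ pq q∤y zero    _ = 1∣ _
^-∣-cancelˡ {q} pq {y} q∤y (suc b) {u} q^∣ with ^-∣-cancelˡ pq q∤y b (m*n∣⇒n∣ q (q ^ b) q^∣)
... | divides u′ refl with euclidsLemma y u′ pq
        (*-cancelʳ-∣ (q ^ b) ⦃ m^n≢0 q b ⦃ prime⇒nonZero pq ⦄ ⦄
          (subst (q ^ suc b ∣_) (sym (*-assoc y u′ (q ^ b))) q^∣))
...   | inj₁ q∣y  = contradiction q∣y q∤y
...   | inj₂ q∣u′ = *-monoˡ-∣ (q ^ b) q∣u′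

-- Powers of distinct primes are coprime: every prime factor of `∏^ n v` is at most `n`, so a prime
-- `suc n` does not divide it, and its power must divide the cofactor.
∏^-∣ : ∀ n v x → SupportedOnPrimes v → (∀ p → p ^ v p ∣ x) → ∏^ n v ∣ x
∏^-∣ zero    v x sup v∣x = 1∣ x
∏^-∣ (suc n) v x sup v∣x with ∏^-∣ n v x sup v∣x | sup (suc n)
... | Π∣x | inj₁ v≡0 rewrite v≡0 | *-identityʳ (∏^ n v) = Π∣x
... | divides u refl | inj₂ psn =
  subst (_∣ u * ∏^ n v) (*-comm _ (∏^ n v)) (*-monoˡ-∣ (∏^ n v)
    (^-∣-cancelˡ psn (λ sn∣ → <-irrefl refl (proj₁ (prime∣∏^⇒ psn n v sup sn∣))) (v (suc n))
      (subst (suc n ^ v (suc n) ∣_) (*-comm u (∏^ n v)) (v∣x (suc n)))))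

-- Together with `∏^≤^∑`, this compares the number of factors, counted by `∑ n v`, with the
-- logarithm of the product, to a base that bounds the factors from below or from above.
^∑≤∏^ : ∀ z n v → (∀ p → v p ≡ 0 ⊎ z ≤ p) → z ^ ∑ n v ≤ ∏^ n v
^∑≤∏^ z zero    v large = ≤-refl
^∑≤∏^ z (suc n) v large rewrite ^-distribˡ-+-* z (∑ n v) (v (suc n)) =
  *-mono-≤ (^∑≤∏^ z n v large) (step (large (suc n)))
  where
  step : v (suc n) ≡ 0 ⊎ z ≤ suc n → z ^ v (suc n) ≤ suc n ^ v (suc n)
  step (inj₁ v≡0) rewrite v≡0 = ≤-refl
  step (inj₂ z≤) = ^-monoˡ-≤ (v (suc n)) z≤

∏^≤^∑ : ∀ N n v → n ≤ N → ∏^ n v ≤ N ^ ∑ n v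
∏^≤^∑ N zero    v n≤N = ≤-refl
∏^≤^∑ N (suc n) v n≤N rewrite ^-distribˡ-+-* N (∑ n v) (v (suc n)) =
  *-mono-≤ (∏^≤^∑ N n v (≤-trans (n≤1+n n) n≤N)) (^-monoˡ-≤ (v (suc n)) n≤N)

∏^>0 : ∀ n v → 0 < ∏^ n v
∏^>0 zero    v = s≤s z≤n
∏^>0 (suc n) v = *-mono-≤ (∏^>0 n v) (m^n>0 (suc n) (v (suc n)))

i^v∣∏^ : ∀ n v i → 1 ≤ i → i ≤ n → i ^ v i ∣ ∏^ n v
i^v∣∏^ zero    v (suc i) 1≤i ()
i^v∣∏^ (suc n) v i 1≤i i≤n with i ≟ suc n
... | yes refl = n∣m*n (∏^ n v)
... | no  i≢   = ∣-trans (i^v∣∏^ n v i 1≤i (s≤s⁻¹ (≤∧≢⇒< i≤n i≢))) (m∣m*n _)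

-- A lower bound for the number of primes

-- The cutoff `w` will be K + R: the selected primes then do not divide K and exceed every shift up
-- to R.
χ : ℕ → ℕ → ℕ
χ w p = 𝟙 (prime? p ×-dec (w <? p))

χ≤1 : ∀ w p → χ w p ≤ 1
χ≤1 w p = 𝟙≤1 (prime? p ×-dec (w <? p))

χ≡1 : ∀ {w p} → Prime p → w < p → χ w p ≡ 1
χ≡1 {w} {p} pp w<p = 𝟙-yes (prime? p ×-dec (w <? p)) (pp , w<p)

χ≢0⇒ : ∀ w p → χ w p ≢ 0 → Prime p × w < p
χ≢0⇒ w p χ≢0 = case prime? p ×-dec (w <? p) of λ where
  (yes x) → x
  (no ¬x) → contradiction (𝟙-no (prime? p ×-dec (w <? p)) ¬x) χ≢0

χ-supported : ∀ w → SupportedOnPrimes (χ w)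
χ-supported w p with χ w p ≟ 0
... | yes χ≡0 = inj₁ χ≡0
... | no  χ≢0 = inj₂ (proj₁ (χ≢0⇒ w p χ≢0))

χ-∣ : ∀ w n q → 1 ≤ q → q ≤ n → χ w q ≡ 1 → q ∣ ∏^ n (χ w)
χ-∣ w n q 1≤q q≤n χ≡1 =
  subst (_∣ ∏^ n (χ w)) (trans (cong (q ^_) χ≡1) (^-identityʳ q)) (i^v∣∏^ n (χ w) q 1≤q q≤n)

-- L · ∫₀¹ xᵃ(1−x)ᵇ dx is an integer, by integrating xᵃ(1−x)ᵇ⁺¹ = xᵃ(1−x)ᵇ − xᵃ⁺¹(1−x)ᵇ.
beta-integral : ∀ L b a → (∀ u → 1 ≤ u → u ≤ suc (a + b) → u ∣ L) →
  ∃[ g ] g * suc (a + b) ! ≡ L * (a ! * b !)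
beta-integral L zero a div with div (suc (a + 0)) (s≤s z≤n) ≤-refl
... | divides g refl rewrite +-identityʳ a = g , assoc g (suc a) (a !)
  where
  assoc : ∀ g s f → g * (s * f) ≡ g * s * (f * 1)
  assoc = solve-∀
beta-integral L (suc b) a div
  with g₁ , eq₁ ← beta-integral L b a (λ u 1≤u u≤ → div u 1≤u (≤-trans u≤ (s≤s (+-monoʳ-≤ a (n≤1+n b)))))
     | g₂ , eq₂ ← beta-integral L b (suc a) (λ u 1≤u u≤ →
                   div u 1≤u (≤-trans u≤ (≤-reflexive (cong suc (sym (+-suc a b))))))
  = g₁ ∸ g₂ , (begin
    (g₁ ∸ g₂) * suc (a + suc b) !
      ≡⟨ cong (λ m → (g₁ ∸ g₂) * suc m !) (+-suc a b) ⟩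
    (g₁ ∸ g₂) * ((2 + (a + b)) * F)
      ≡⟨ *-distribʳ-∸ ((2 + (a + b)) * F) g₁ g₂ ⟩
    g₁ * ((2 + (a + b)) * F) ∸ g₂ * ((2 + (a + b)) * F)
      ≡⟨ cong₂ _∸_ (trans (r₁ g₁ (2 + (a + b)) F) (cong ((2 + (a + b)) *_) eq₁)) eq₂ ⟩
    (2 + (a + b)) * (L * (a ! * b !)) ∸ L * (suc a * a ! * b !)
      ≡⟨ cong (_∸ L * (suc a * a ! * b !)) (r₂ a b L (a !) (b !)) ⟩
    L * (a ! * (suc b * b !)) + L * (suc a * a ! * b !) ∸ L * (suc a * a ! * b !)
      ≡⟨ m+n∸n≡m _ (L * (suc a * a ! * b !)) ⟩
    L * (a ! * (suc b * b !)) ∎)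
  where
  open ≡-Reasoning
  F : ℕ
  F = suc (a + b) !
  r₁ : ∀ g s f → g * (s * f) ≡ s * (g * f)
  r₁ = solve-∀
  r₂ : ∀ a b L x y → (2 + (a + b)) * (L * (x * y)) ≡ L * (x * (suc b * y)) + L * (suc a * x * y)
  r₂ = solve-∀

n!>0 : ∀ n → 0 < n !
n!>0 zero    = s≤s z≤n
n!>0 (suc n) = *-mono-≤ {1} {suc n} (s≤s z≤n) (n!>0 n)

-- This bounds ∫₀¹ xⁿ(1-x)ⁿ dx by 1/2ⁿ. Passing to n + 1 multiplies the right side by (2n+3)(2n+2)
-- and the left side by only 2(n+1)².
2^n*n!*n!≤[2n+1]! : ∀ n → 2 ^ n * (n ! * n !) ≤ suc (n + n) !
2^n*n!*n!≤[2n+1]! zero    = ≤-refl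
2^n*n!*n!≤[2n+1]! (suc n) = begin
  2 * 2 ^ n * (suc n * n ! * (suc n * n !))              ≡⟨ r₁ n (2 ^ n) (n !) ⟩
  2 * (suc n * suc n) * (2 ^ n * (n ! * n !))            ≤⟨ *-monoʳ-≤ (2 * (suc n * suc n)) (2^n*n!*n!≤[2n+1]! n) ⟩
  2 * (suc n * suc n) * suc (n + n) !                    ≤⟨ *-monoˡ-≤ (suc (n + n) !) (m≤m+n (2 * (suc n * suc n)) _) ⟩
  (2 * (suc n * suc n) + (2 + n) * (2 * suc n)) * suc (n + n) ! ≡⟨ r₂ n (suc (n + n) !) ⟩
  (3 + (n + n)) * ((2 + (n + n)) * suc (n + n) !)        ≡⟨ cong (λ m → suc (suc m) !) (+-suc n n) ⟨
  suc (suc n + suc n) !                                  ∎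
  where
  open ≤-Reasoning
  r₁ : ∀ n t f → 2 * t * (suc n * f * (suc n * f)) ≡ 2 * (suc n * suc n) * (t * (f * f))
  r₁ = solve-∀
  r₂ : ∀ n F → (2 * (suc n * suc n) + (2 + n) * (2 * suc n)) * F ≡ (3 + (n + n)) * ((2 + (n + n)) * F)
  r₂ = solve-∀

-- Nair's argument: `L` times the beta integral is a positive integer, so `L` is at least the
-- reciprocal of the integral.
common-multiple≥2^n : ∀ L n → 0 < L → (∀ u → 1 ≤ u → u ≤ suc (n + n) → u ∣ L) → 2 ^ n ≤ L
common-multiple≥2^n L n L>0 div with beta-integral L n n div
... | zero  , eq = contradiction eq (<⇒≢ (*-mono-≤ {1} L>0 (*-mono-≤ {1} (n!>0 n) (n!>0 n))))
... | suc g , eq = *-cancelʳ-≤ (2 ^ n) L (n ! * n !) ⦃ >-nonZero (*-mono-≤ {1} (n!>0 n) (n!>0 n)) ⦄ (begin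
  2 ^ n * (n ! * n !)       ≤⟨ 2^n*n!*n!≤[2n+1]! n ⟩
  suc (n + n) !             ≤⟨ m≤m+n (suc (n + n) !) _ ⟩
  suc g * suc (n + n) !     ≡⟨ eq ⟩
  L * (n ! * n !)           ∎)
  where open ≤-Reasoning

prime-divisor : ∀ u → 2 ≤ u → ∃[ p ] Prime p × p ∣ u
prime-divisor u 2≤u with factorise u ⦃ >-nonZero (≤-trans (n≤1+n 1) 2≤u) ⦄
... | record { factors = []     ; isFactorisation = refl } = contradiction 2≤u (<⇒≱ (s≤s (s≤s z≤n)))
... | record { factors = p ∷ ps ; isFactorisation = refl ; factorsPrime = pp All.∷ _ } = p , pp , m∣m*n _

-- At most `j` primes, counted with multiplicity, fit into `u ≤ 2 ^ j`, and each divides `Q`: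
-- splitting off one prime at least halves `u`. A power of `Q` thus stands in for a least common
-- multiple.
∣radical^ : ∀ {N Q} → (∀ p → Prime p → p ≤ N → p ∣ Q) →
  ∀ j u → 1 ≤ u → u ≤ N → u ≤ 2 ^ j → u ∣ Q ^ j
∣radical^ div zero    u 1≤u u≤N u≤1 rewrite ≤-antisym u≤1 1≤u = ∣-refl
∣radical^ {N} {Q} div (suc j) u 1≤u u≤N u≤ with u ≟ 1
... | yes refl = 1∣ _
... | no  u≢1  with prime-divisor u (≤∧≢⇒< 1≤u (≢-sym u≢1))
...   | p , pp , divides v refl = subst (_∣ Q ^ suc j) (*-comm p v)
          (*-pres-∣ {p} {Q} {v} {Q ^ j} (div p pp (≤-trans (∣⇒≤ ⦃ >-nonZero 1≤u ⦄ (n∣m*n v)) u≤N))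
                    (∣radical^ div j v 1≤v (≤-trans v≤vp u≤N) v≤2^j))
  where
  1≤v : 1 ≤ v
  1≤v = n≢0⇒n>0 λ { refl → contradiction 1≤u λ () }
  v≤vp : v ≤ v * p
  v≤vp = m≤m*n v p ⦃ prime⇒nonZero pp ⦄
  v≤2^j : v ≤ 2 ^ j
  v≤2^j = *-cancelˡ-≤ 2 (≤-trans (≤-trans (≤-reflexive (*-comm 2 v)) (*-monoʳ-≤ v (prime>1 pp))) u≤)

2^-cancel-≤ : ∀ {a b} → 2 ^ a ≤ 2 ^ b → a ≤ b
2^-cancel-≤ 2^a≤2^b = ≮⇒≥ λ b<a → <⇒≱ (^-monoʳ-< 2 ≤-refl b<a) 2^a≤2^b

-- With `Q` the product of the primes up to `N = 2 ^ i`, the common multiple `Q ^ i` is at least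
-- 2^(2^j) and at most 2^(i²π). This loses one logarithm against Chebyshev's bound, which is
-- harmless here.
prime-count-lower : ∀ j → 2 ^ j ≤ (2 + j) * (∑ (2 ^ (2 + j)) (χ 0) * (2 + j))
prime-count-lower j = 2^-cancel-≤ (begin
  2 ^ (2 ^ j)                 ≤⟨ common-multiple≥2^n (Q ^ i) (2 ^ j) (m^n>0 Q ⦃ >-nonZero (∏^>0 N (χ 0)) ⦄ i) div ⟩
  Q ^ i                       ≤⟨ ^-monoˡ-≤ i (∏^≤^∑ N N (χ 0) ≤-refl) ⟩
  (N ^ π) ^ i                 ≡⟨ ^-*-assoc N π i ⟩
  (2 ^ i) ^ (π * i)           ≡⟨ ^-*-assoc 2 i (π * i) ⟩
  2 ^ (i * (π * i))           ∎)
  where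
  open ≤-Reasoning
  i N Q π : ℕ
  -- The factor 4 in `2 ^ i` makes room for 2 · 2^j + 1, the range required by
  -- `common-multiple≥2^n`.
  i = 2 + j
  N = 2 ^ i
  Q = ∏^ N (χ 0)
  π = ∑ N (χ 0)
  2n+1≤N : suc (2 ^ j + 2 ^ j) ≤ N
  2n+1≤N = begin
    1 + (2 ^ j + 2 ^ j)             ≤⟨ +-monoˡ-≤ _ (m^n>0 2 j) ⟩
    2 ^ j + (2 ^ j + 2 ^ j)         ≤⟨ m≤m+n _ (2 ^ j) ⟩
    2 ^ j + (2 ^ j + 2 ^ j) + 2 ^ j ≡⟨ r (2 ^ j) ⟩
    N                               ∎
    where
    r : ∀ x → x + (x + x) + x ≡ 2 * (2 * x)
    r = solve-∀
  div : ∀ u → 1 ≤ u → u ≤ suc (2 ^ j + 2 ^ j) → u ∣ Q ^ i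
  div u 1≤u u≤ = ∣radical^
    (λ p pp p≤N → let 1≤p = <⇒≤ (prime>1 pp) in χ-∣ 0 N p 1≤p p≤N (χ≡1 pp 1≤p))
    i u 1≤u (≤-trans u≤ 2n+1≤N) (≤-trans u≤ 2n+1≤N)

∑-𝟙-≤? : ∀ n w → ∑ n (λ i → 𝟙 (i ≤? w)) ≤ w
∑-𝟙-≤? zero    w = z≤n
∑-𝟙-≤? (suc n) w = case suc n ≤? w of λ where
  (yes n<w) → ≤-trans (∑-mono-≤ (suc n) (λ i _ _ → 𝟙≤1 (i ≤? w)))
                (≤-trans (≤-reflexive (trans (∑-const (suc n) 1) (*-identityʳ _))) n<w)
  (no  n≮w) → subst (_≤ w) (sym (trans (cong (∑ n (λ i → 𝟙 (i ≤? w)) +_) (𝟙-no (suc n ≤? w) n≮w)) (+-identityʳ _)))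
                (∑-𝟙-≤? n w)

∑χ₀≤w+∑χ : ∀ w n → ∑ n (χ 0) ≤ w + ∑ n (χ w)
∑χ₀≤w+∑χ w n = begin
  ∑ n (χ 0)                                ≤⟨ ∑-mono-≤ n (λ p _ _ → split p) ⟩
  ∑ n (λ p → 𝟙 (p ≤? w) + χ w p)           ≡⟨ ∑-+ n _ _ ⟩
  ∑ n (λ p → 𝟙 (p ≤? w)) + ∑ n (χ w)       ≤⟨ +-monoˡ-≤ _ (∑-𝟙-≤? n w) ⟩
  w + ∑ n (χ w)                            ∎
  where
  open ≤-Reasoning
  split : ∀ p → χ 0 p ≤ 𝟙 (p ≤? w) + χ w p
  split p = case p ≤? w of λ where
    (yes p≤w) → ≤-trans (χ≤1 0 p) (≤-trans (≤-reflexive (sym (𝟙-yes (p ≤? w) p≤w))) (m≤m+n _ _))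
    (no  p≰w) → ≤-trans (𝟙-mono (prime? p ×-dec (0 <? p)) (prime? p ×-dec (w <? p)) (λ x → proj₁ x , ≰⇒> p≰w))
                  (m≤n+m _ _)

-- A discrete intermediate value argument: the partial sums start at 0 and grow in steps of at most
-- 1.
∑-attains : ∀ f → (∀ i → f i ≤ 1) → ∀ N T → T ≤ ∑ N f → ∃[ n ] n ≤ N × ∑ n f ≡ T
∑-attains f f≤1 zero    T T≤ = 0 , z≤n , sym (n≤0⇒n≡0 T≤)
∑-attains f f≤1 (suc N) T T≤ with T ≤? ∑ N f
... | yes T≤′ = let n , n≤N , eq = ∑-attains f f≤1 N T T≤′ in n , m≤n⇒m≤1+n n≤N , eq
... | no  T≰  = suc N , ≤-refl , ≤-antisym
      (≤-trans (+-monoʳ-≤ (∑ N f) (f≤1 (suc N))) (≤-trans (≤-reflexive (+-comm _ 1)) (≰⇒> T≰))) T≤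

quadratic≤2^ : ∀ y → 8 ≤ y → 2 * (y * y) + 3 * y ≤ 2 ^ y
quadratic≤2^ y 8≤y = subst (λ y → 2 * (y * y) + 3 * y ≤ 2 ^ y) (m+[n∸m]≡n 8≤y) (go (y ∸ 8))
  where
  open ≤-Reasoning
  r : ∀ k → 2 * ((9 + k) * (9 + k)) + 3 * (9 + k) + (2 * (k * k) + 31 * k + 115)
          ≡ 2 * (2 * ((8 + k) * (8 + k)) + 3 * (8 + k))
  r = solve-∀
  go : ∀ k → 2 * ((8 + k) * (8 + k)) + 3 * (8 + k) ≤ 2 ^ (8 + k)
  go zero    = ≤ᵇ⇒≤ 152 256 _
  go (suc k) = subst (λ m → 2 * (m * m) + 3 * m ≤ 2 ^ m) (sym (+-suc 8 k)) (begin
    2 * ((9 + k) * (9 + k)) + 3 * (9 + k)         ≤⟨ m≤m+n _ _ ⟩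
    2 * ((9 + k) * (9 + k)) + 3 * (9 + k) + (2 * (k * k) + 31 * k + 115) ≡⟨ r k ⟩
    2 * (2 * ((8 + k) * (8 + k)) + 3 * (8 + k))   ≤⟨ *-monoʳ-≤ 2 (go k) ⟩
    2 ^ (9 + k)                                   ∎)

quartic<2^ : ∀ y → 8 ≤ y → 4 * ((4 * y) * ((y + y * (4 * y)) * (4 * y))) < 2 ^ (4 * y)
quartic<2^ y 8≤y = begin-strict
  4 * ((4 * y) * ((y + y * (4 * y)) * (4 * y))) ≡⟨ r₁ y ⟩
  64 * y³ + 256 * (y³ * y)                     ≤⟨ +-monoˡ-≤ _ (m≤m*n (64 * y³) y ⦃ >-nonZero 0<y ⦄) ⟩
  64 * y³ * y + 256 * (y³ * y)                 ≡⟨ r₂ y³ y ⟩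
  320 * (y³ * y)                               <⟨ *-monoˡ-< (y³ * y) ⦃ >-nonZero (*-mono-≤ 0<y³ 0<y) ⦄ 320<16y⁴ ⟩
  16 * (y³ * y) * (y³ * y)                     ≡⟨ r₃ y ⟩
  (2 * (y * y)) ^ 4                            ≤⟨ ^-monoˡ-≤ 4 (≤-trans (m≤m+n (2 * (y * y)) _) (quadratic≤2^ y 8≤y)) ⟩
  (2 ^ y) ^ 4                                  ≡⟨ ^-*-assoc 2 y 4 ⟩
  2 ^ (y * 4)                                  ≡⟨ cong (2 ^_) (*-comm y 4) ⟩
  2 ^ (4 * y)                                  ∎
  where
  open ≤-Reasoning
  y³ : ℕ
  y³ = y * y * y
  0<y : 0 < y
  0<y = ≤-trans (s≤s z≤n) 8≤y
  0<y³ : 0 < y³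
  0<y³ = *-mono-≤ (*-mono-≤ 0<y 0<y) 0<y
  320<16y⁴ : 320 < 16 * (y³ * y)
  320<16y⁴ = ≤-trans (≤ᵇ⇒≤ 321 65536 _)
    (*-monoʳ-≤ 16 (*-mono-≤ (*-mono-≤ (*-mono-≤ 8≤y 8≤y) 8≤y) 8≤y))
  r₁ : ∀ y → 4 * ((4 * y) * ((y + y * (4 * y)) * (4 * y))) ≡ 64 * (y * y * y) + 256 * (y * y * y * y)
  r₁ = solve-∀
  r₂ : ∀ c y → 64 * c * y + 256 * (c * y) ≡ 320 * (c * y)
  r₂ = solve-∀
  r₃ : ∀ y → 16 * (y * y * y * y) * (y * y * y * y)
     ≡ (2 * (y * y)) * ((2 * (y * y)) * ((2 * (y * y)) * ((2 * (y * y)) * 1)))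
  r₃ = solve-∀

-- This says π(x) / log x → ∞, which is all that the argument needs from prime number theory.
prime-supply : ∀ w c b → ∃[ j ] b ≤ j × ∃[ N ] N ≤ 2 ^ j × ∑ N (χ w) ≡ c * j
prime-supply w c b = j , b≤j , ∑-attains (χ w) (χ≤1 w) (2 ^ j) (c * j)
  (+-cancelˡ-≤ w _ _ (≤-trans (<⇒≤ count) (∑χ₀≤w+∑χ w (2 ^ j))))
  where
  open ≤-Reasoning
  x y j i : ℕ
  -- This makes `y` at least 8, `w`, `c` and `b` at once, while `i = j - 2` is the argument for
  -- which `prime-count-lower` speaks of the primes up to `2 ^ j`.
  x = 7 + w + c + b
  y = suc x
  j = 4 * y
  i = 2 + 4 * x
  2+i≡j : 2 + i ≡ j
  2+i≡j = r x
    where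
    r : ∀ x → 2 + (2 + 4 * x) ≡ 4 * (1 + x)
    r = solve-∀
  b≤j : b ≤ j
  b≤j = ≤-trans (m≤n+m b (8 + w + c)) (m≤n*m y 4)
  w≤y : w ≤ y
  w≤y = ≤-trans (m≤n+m w 8) (≤-trans (m≤m+n (8 + w) c) (m≤m+n (8 + w + c) b))
  c≤y : c ≤ y
  c≤y = ≤-trans (m≤n+m c (8 + w)) (m≤m+n (8 + w + c) b)
  lower : 2 ^ j ≤ 4 * (j * (∑ (2 ^ j) (χ 0) * j))
  lower = subst (λ j → 2 ^ j ≤ 4 * (j * (∑ (2 ^ j) (χ 0) * j))) 2+i≡j
    (≤-trans (≤-reflexive (r (2 ^ i))) (*-monoʳ-≤ 4 (prime-count-lower i)))
    where
    r : ∀ x → 2 * (2 * x) ≡ 4 * x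
    r = solve-∀
  count : w + c * j < ∑ (2 ^ j) (χ 0)
  count = ≰⇒> λ π≤ → <⇒≱ (quartic<2^ y (≤-trans (m≤m+n 8 w) (≤-trans (m≤m+n _ c) (m≤m+n _ b)))) (begin
    2 ^ j                                ≤⟨ lower ⟩
    4 * (j * (∑ (2 ^ j) (χ 0) * j))      ≤⟨ *-monoʳ-≤ 4 (*-monoʳ-≤ j (*-monoˡ-≤ j
                                              (≤-trans π≤ (+-mono-≤ w≤y (*-monoˡ-≤ j c≤y))))) ⟩
    4 * (j * ((y + y * j) * j))          ∎)

-- The average of Ω along an arithmetic progression

-- The induction carries the last hit along, since each new one lies at least `u` beyond it. The
-- first hit is free, hence `c ∸ 1`.
spaced-hits : ∀ {P : ℕ → Set} (P? : ∀ i → Dec (P i)) u →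
  (∀ {m n} → m < n → P m → P n → u + m ≤ n) →
  ∀ M → let c = ∑ M (λ m → 𝟙 (P? m)) in
  c ≡ 0 ⊎ ∃[ m ] m ≤ M × P m × u * (c ∸ 1) ≤ m
spaced-hits P? u gap zero    = inj₁ refl
spaced-hits {P} P? u gap (suc M) = case P? (suc M) of λ where
    (no ¬x) → subst Goal (sym (trans (cong (c +_) (𝟙-no (P? (suc M)) ¬x)) (+-identityʳ c)))
                (weaken (spaced-hits P? u gap M))
    (yes x) → subst Goal (sym (trans (cong (c +_) (𝟙-yes (P? (suc M)) x)) (+-comm c 1)))
                (inj₂ (suc M , ≤-refl , x , extend x (spaced-hits P? u gap M)))
  where
  open ≤-Reasoning
  c : ℕ
  c = ∑ M (λ m → 𝟙 (P? m))
  Goal : ℕ → Set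
  Goal c = c ≡ 0 ⊎ ∃[ m ] m ≤ suc M × P m × u * (c ∸ 1) ≤ m
  weaken : c ≡ 0 ⊎ (∃[ m ] m ≤ M × P m × u * (c ∸ 1) ≤ m) → Goal c
  weaken (inj₁ c≡0) = inj₁ c≡0
  weaken (inj₂ (m , m≤M , x , bd)) = inj₂ (m , m≤n⇒m≤1+n m≤M , x , bd)
  extend : P (suc M) → c ≡ 0 ⊎ (∃[ m ] m ≤ M × P m × u * (c ∸ 1) ≤ m) → u * c ≤ suc M
  extend x (inj₁ c≡0) rewrite c≡0 | *-zeroʳ u = z≤n
  extend x (inj₂ (m , m≤M , y , bd)) = begin
    u * c                 ≤⟨ *-monoʳ-≤ u (m≤n+m∸n c 1) ⟩
    u * (1 + (c ∸ 1))     ≡⟨ *-suc u (c ∸ 1) ⟩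
    u + u * (c ∸ 1)       ≤⟨ +-monoʳ-≤ u bd ⟩
    u + m                 ≤⟨ gap (s≤s m≤M) y x ⟩
    suc M                 ∎

-- The two terms differ by `B * (n ∸ m)`, and the factor `B` can be cancelled because `p` does not
-- divide it.
prime-power-gap : ∀ {p} → Prime p → ∀ {A B} → ¬ p ∣ B → ∀ e {m n} → m < n →
  p ^ e ∣ A + B * m → p ^ e ∣ A + B * n → p ^ e + m ≤ n
prime-power-gap {p} pp {A} {B} p∤B e {m} {n} m<n d₁ d₂ =
  ≤-trans (+-monoˡ-≤ m (∣⇒≤ ⦃ >-nonZero (m<n⇒0<n∸m m<n) ⦄ p^e∣n∸m)) (≤-reflexive (m∸n+n≡m (<⇒≤ m<n)))
  where
  eq : A + B * n ≡ (A + B * m) + B * (n ∸ m)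
  eq = trans (cong (λ k → A + B * k) (sym (m+[n∸m]≡n (<⇒≤ m<n)))) (r A B m (n ∸ m))
    where
    r : ∀ A B m k → A + B * (m + k) ≡ (A + B * m) + B * k
    r = solve-∀
  p^e∣n∸m : p ^ e ∣ n ∸ m
  p^e∣n∸m = ^-∣-cancelˡ pp p∤B e (∣m+n∣m⇒∣n (subst (p ^ e ∣_) eq d₂) d₁)

∑-geometric : ∀ M (g : ℕ → ℕ) → (∀ e → 2 ^ e * g (suc e) ≤ M) → ∀ E → ∑ E g ≤ 2 * M
∑-geometric M g bd E = *-cancelˡ-≤ (2 ^ E) ⦃ m^n≢0 2 E ⦄ (m+n≤o⇒m≤o _ (go E))
  where
  open ≤-Reasoning
  r₁ : ∀ t a g M → 2 * t * (a + g) + 2 * M ≡ 2 * (t * a + M) + 2 * (t * g)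
  r₁ = solve-∀
  r₂ : ∀ x M → 2 * (x + M) + 2 * M ≡ 2 * (x + 2 * M)
  r₂ = solve-∀
  r₃ : ∀ t M → 2 * (t * M) ≡ 2 * t * M
  r₃ = solve-∀
  -- The bound is sharpened to ∑ ≤ 2M(1 - 1/2^E), cleared of denominators; without the subtracted
  -- part the induction would not close.
  go : ∀ E → 2 ^ E * ∑ E g + 2 * M ≤ 2 ^ E * (2 * M)
  go zero    = ≤-reflexive (sym (*-identityˡ _))
  go (suc E) = begin
    2 * 2 ^ E * (∑ E g + g (suc E)) + 2 * M           ≡⟨ r₁ (2 ^ E) (∑ E g) (g (suc E)) M ⟩
    2 * (2 ^ E * ∑ E g + M) + 2 * (2 ^ E * g (suc E)) ≤⟨ +-monoʳ-≤ (2 * (2 ^ E * ∑ E g + M)) (*-monoʳ-≤ 2 (bd E)) ⟩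
    2 * (2 ^ E * ∑ E g + M) + 2 * M                   ≡⟨ r₂ (2 ^ E * ∑ E g) M ⟩
    2 * (2 ^ E * ∑ E g + 2 * M)                       ≤⟨ *-monoʳ-≤ 2 (go E) ⟩
    2 * (2 ^ E * (2 * M))                             ≡⟨ r₃ (2 ^ E) (2 * M) ⟩
    2 * 2 ^ E * (2 * M)                               ∎

-- Multiples of p^e lie p^e apart, so beyond the first there are at most M/p^e of them. Summing over
-- e, the first hits cost at most `E`, and the excess `h` is a geometric sum of order M/p.
∑-val-progression : ∀ {p} → Prime p → ∀ {A B} → ¬ p ∣ B → ∀ M E →
  (∀ m → 1 ≤ m → m ≤ M → 1 ≤ A + B * m × A + B * m < 2 ^ E) →
  ∃[ h ] p * h ≤ 2 * M × ∑ M (λ m → val p (A + B * m)) ≤ h + E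
∑-val-progression {p} pp {A} {B} p∤B M E size = ∑ E excess , ph≤2M , bound
  where
  open ≤-Reasoning
  hit? : ∀ e m → Dec (p ^ e ∣ A + B * m)
  hit? e m = (p ^ e) ∣? (A + B * m)
  hits excess : ℕ → ℕ
  hits e = ∑ M (λ m → 𝟙 (hit? e m))
  excess e = hits e ∸ 1
  p^e*excess≤M : ∀ e → p ^ e * excess e ≤ M
  p^e*excess≤M e with spaced-hits (hit? e) (p ^ e) (prime-power-gap pp p∤B e) M
  ... | inj₁ c≡0 rewrite c≡0 | *-zeroʳ (p ^ e) = z≤n
  ... | inj₂ (m , m≤M , _ , bd) = ≤-trans bd m≤M
  ph≤2M : p * ∑ E excess ≤ 2 * M
  ph≤2M = subst (_≤ 2 * M) (∑-*ˡ E p excess) (∑-geometric M (λ e → p * excess e)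
    (λ e → begin
      2 ^ e * (p * excess (suc e)) ≤⟨ *-monoˡ-≤ _ (^-monoˡ-≤ e (prime>1 pp)) ⟩
      p ^ e * (p * excess (suc e)) ≡⟨ r (p ^ e) p _ ⟩
      p ^ suc e * excess (suc e)   ≤⟨ p^e*excess≤M (suc e) ⟩
      M                            ∎) E)
    where
    r : ∀ t p x → t * (p * x) ≡ p * t * x
    r = solve-∀
  bound : ∑ M (λ m → val p (A + B * m)) ≤ ∑ E excess + E
  bound = begin
    ∑ M (λ m → val p (A + B * m))
      ≤⟨ ∑-mono-≤ M (λ m 1≤m m≤M → val≤∑ {E = E} (prime>1 pp) (proj₁ (size m 1≤m m≤M)) (proj₂ (size m 1≤m m≤M))) ⟩
    ∑ M (λ m → ∑ E (λ e → 𝟙 (hit? e m)))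
      ≡⟨ ∑-swap M E (λ m e → 𝟙 (hit? e m)) ⟩
    ∑ E hits
      ≤⟨ ∑-mono-≤ E (λ e _ _ → ≤-trans (m≤n+m∸n (hits e) 1) (≤-reflexive (+-comm 1 _))) ⟩
    ∑ E (λ e → excess e + 1)
      ≡⟨ ∑-+ E excess (λ _ → 1) ⟩
    ∑ E excess + ∑ E (λ _ → 1)
      ≡⟨ cong (∑ E excess +_) (trans (∑-const E 1) (*-identityʳ E)) ⟩
    ∑ E excess + E ∎

∑-split : ∀ m n f → ∑ (m + n) f ≡ ∑ m f + ∑ n (λ i → f (m + i))
∑-split m zero    f rewrite +-identityʳ m = sym (+-identityʳ _)
∑-split m (suc n) f rewrite +-suc m n | ∑-split m n f = +-assoc (∑ m f) _ _

-- Dyadic blocks: each of the 2^s terms with index in (2^s, 2^(s+1)] is at most M/2^s, so a block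
-- contributes at most `M`.
∑-harmonic : ∀ M (h : ℕ → ℕ) → (∀ p → 1 ≤ p → p * h p ≤ M) → ∀ s → ∑ (2 ^ s) h ≤ suc s * M
∑-harmonic M h bd zero    = ≤-trans (≤-reflexive (sym (+-identityʳ _))) (≤-trans (bd 1 ≤-refl) (m≤m+n M _))
∑-harmonic M h bd (suc s) = begin
  ∑ (2 ^ s + (2 ^ s + 0)) h                   ≡⟨ cong (λ n → ∑ (2 ^ s + n) h) (+-identityʳ _) ⟩
  ∑ (2 ^ s + 2 ^ s) h                         ≡⟨ ∑-split (2 ^ s) (2 ^ s) h ⟩
  ∑ (2 ^ s) h + ∑ (2 ^ s) (λ i → h (2 ^ s + i)) ≤⟨ +-mono-≤ (∑-harmonic M h bd s) block ⟩
  suc s * M + M                               ≡⟨ +-comm _ M ⟩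
  suc (suc s) * M                             ∎
  where
  open ≤-Reasoning
  block : ∑ (2 ^ s) (λ i → h (2 ^ s + i)) ≤ M
  block = *-cancelˡ-≤ (2 ^ s) ⦃ m^n≢0 2 s ⦄ (begin
    2 ^ s * ∑ (2 ^ s) (λ i → h (2 ^ s + i))     ≡⟨ ∑-*ˡ (2 ^ s) (2 ^ s) _ ⟨
    ∑ (2 ^ s) (λ i → 2 ^ s * h (2 ^ s + i))     ≤⟨ ∑-mono-≤ (2 ^ s) (λ i 1≤i _ →
                                                     ≤-trans (*-monoˡ-≤ (h (2 ^ s + i)) (m≤m+n (2 ^ s) i))
                                                             (bd (2 ^ s + i) (≤-trans 1≤i (m≤n+m i (2 ^ s))))) ⟩
    ∑ (2 ^ s) (λ _ → M)                         ≡⟨ ∑-const (2 ^ s) M ⟩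
    2 ^ s * M                                   ∎)

primeVal : ℕ → ℕ → ℕ
primeVal n p = 𝟙 (prime? p) * val p n

Ω≤∑primeVal : ∀ n → Ω n ≤ ∑ n (primeVal n)
Ω≤∑primeVal n = ≤-trans (≤-reflexive (Ω≡∑ n))
  (∑-mono-≤ n (λ p _ _ → *-monoˡ-≤ (val p n) (𝟙-mono (prime? p ×-dec (p ∣? n)) (prime? p) proj₁)))

∑-cutoff : ∀ Z n f → ∑ n f ≤ ∑ Z f + ∑ n (λ p → 𝟙 (Z <? p) * f p)
∑-cutoff Z zero    f = z≤n
∑-cutoff Z (suc n) f = case Z <? suc n of λ where
    (yes Z<) → begin
      ∑ n f + f (suc n)              ≤⟨ +-monoˡ-≤ (f (suc n)) (∑-cutoff Z n f) ⟩
      ∑ Z f + rest + f (suc n)       ≡⟨ +-assoc (∑ Z f) rest _ ⟩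
      ∑ Z f + (rest + f (suc n))     ≡⟨ cong (λ c → ∑ Z f + (rest + c))
                                          (trans (sym (*-identityˡ _))
                                          (cong (_* f (suc n)) (sym (𝟙-yes (Z <? suc n) Z<)))) ⟩
      ∑ Z f + (rest + 𝟙 (Z <? suc n) * f (suc n)) ∎
    (no Z≮) → ≤-trans (∑-monoˡ-≤ f (≮⇒≥ Z≮)) (m≤m+n _ _)
  where
  open ≤-Reasoning
  rest : ℕ
  rest = ∑ n (λ p → 𝟙 (Z <? p) * f p)

-- The part of `n` composed of primes above 2^s divides `n`. If it had more than `L` prime factors
-- it would be at least 2^(sL), hence exceed `n`.
∑-large-primeVal : ∀ s L {E} n → 1 ≤ n → n < 2 ^ E → E ≤ s * L →
  ∑ n (λ p → 𝟙 (2 ^ s <? p) * primeVal n p) ≤ L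
∑-large-primeVal s L {E} n 1≤n n<2^E E≤sL = ≮⇒≥ λ L<c → <-irrefl refl (begin-strict
  n               <⟨ n<2^E ⟩
  2 ^ E           ≤⟨ ^-monoʳ-≤ 2 (≤-trans E≤sL (*-monoʳ-≤ s (<⇒≤ L<c))) ⟩
  2 ^ (s * ∑ n v) ≡⟨ ^-*-assoc 2 s (∑ n v) ⟨
  (2 ^ s) ^ ∑ n v ≤⟨ ^∑≤∏^ (2 ^ s) n v large ⟩
  ∏^ n v          ≤⟨ ∣⇒≤ ⦃ >-nonZero 1≤n ⦄ (∏^-∣ n v n supported divides-n) ⟩
  n               ∎)
  where
  open ≤-Reasoning
  v : ℕ → ℕ
  v p = 𝟙 (2 ^ s <? p) * primeVal n p
  large : ∀ p → v p ≡ 0 ⊎ 2 ^ s ≤ p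
  large p = case 2 ^ s <? p of λ where
    (yes s<p) → inj₂ (<⇒≤ s<p)
    (no  s≮p) → inj₁ (cong (_* primeVal n p) (𝟙-no (2 ^ s <? p) s≮p))
  supported : SupportedOnPrimes v
  supported p = case prime? p of λ where
    (yes pp) → inj₂ pp
    (no ¬pp) → inj₁ (trans (cong (λ c → 𝟙 (2 ^ s <? p) * (c * val p n)) (𝟙-no (prime? p) ¬pp))
                           (*-zeroʳ (𝟙 (2 ^ s <? p))))
  v≤val : ∀ p → v p ≤ val p n
  v≤val p = ≤-trans (*-mono-≤ (𝟙≤1 (2 ^ s <? p)) (*-monoˡ-≤ (val p n) (𝟙≤1 (prime? p))))
    (≤-reflexive (trans (*-identityˡ _) (*-identityˡ _)))
  divides-n : ∀ p → p ^ v p ∣ n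
  divides-n p = downward-≤ {λ e → p ^ e ∣ n} (^-∣-downward p n) (v≤val p) (p^val∣n p n)

-- K and l only serve to absorb the primes dividing the common difference B.
∑-Ω-progression : ∀ A B M E s L K l →
  (∀ m → 1 ≤ m → m ≤ M → 1 ≤ A + B * m × A + B * m < 2 ^ E) →
  (∀ p → Prime p → p ∣ B → ∀ m → val p (A + B * m) ≤ 𝟙 (p ≤? K) * l) →
  2 ^ s * E ≤ M → E ≤ s * L →
  ∑ M (λ m → Ω (A + B * m)) ≤ M * (L + (2 * suc s + (1 + K * l)))
∑-Ω-progression A B M E s L K l size ramified ZE≤M E≤sL = begin
  ∑ M (λ m → Ω (x m))
    ≤⟨ ∑-mono-≤ M (λ m 1≤m m≤M → ≤-trans (Ω≤∑primeVal (x m)) (≤-trans (∑-cutoff Z (x m) (primeVal (x m)))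
         (+-monoʳ-≤ _ (∑-large-primeVal s L (x m) (proj₁ (size m 1≤m m≤M)) (proj₂ (size m 1≤m m≤M)) E≤sL)))) ⟩
  ∑ M (λ m → ∑ Z (primeVal (x m)) + L)
    ≡⟨ trans (∑-+ M _ (λ _ → L)) (cong₂ _+_ (∑-swap M Z (λ m → primeVal (x m))) (∑-const M L)) ⟩
  ∑ Z total + M * L
    ≤⟨ +-monoˡ-≤ (M * L) (∑-mono-≤ Z (λ p _ _ →
         ≤-trans (m≤n+m∸n (total p) (error p)) (≤-reflexive (+-comm (error p) (h p))))) ⟩
  ∑ Z (λ p → h p + error p) + M * L
    ≡⟨ cong (_+ M * L) (trans (∑-+ Z h error) (cong (∑ Z h +_) (∑-+ Z (λ _ → E) _))) ⟩
  ∑ Z h + (∑ Z (λ _ → E) + ∑ Z (λ p → 𝟙 (p ≤? K) * (l * M))) + M * L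
    ≤⟨ +-monoˡ-≤ (M * L) (+-mono-≤ (∑-harmonic (2 * M) h (λ p 1≤p → p*h≤2M p) s)
         (+-mono-≤ (≤-trans (≤-reflexive (∑-const Z E)) ZE≤M) K-part)) ⟩
  suc s * (2 * M) + (M + l * M * K) + M * L
    ≡⟨ r s M l K L ⟩
  M * (L + (2 * suc s + (1 + K * l))) ∎
  where
  open ≤-Reasoning
  Z : ℕ
  Z = 2 ^ s
  x total error h : ℕ → ℕ
  x m = A + B * m
  total p = ∑ M (λ m → primeVal (x m) p)
  -- A prime not dividing `B` costs at most 2M/p + E in total, a prime dividing `B` at most l M.
  -- With these errors removed, `h` satisfies the hypothesis of `∑-harmonic`.
  error p = E + 𝟙 (p ≤? K) * (l * M)
  h p = total p ∸ error p
  r : ∀ s M l K L → suc s * (2 * M) + (M + l * M * K) + M * L ≡ M * (L + (2 * suc s + (1 + K * l)))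
  r = solve-∀
  K-part : ∑ Z (λ p → 𝟙 (p ≤? K) * (l * M)) ≤ l * M * K
  K-part = begin
    ∑ Z (λ p → 𝟙 (p ≤? K) * (l * M)) ≡⟨ ∑-cong Z (λ p → *-comm (𝟙 (p ≤? K)) (l * M)) ⟩
    ∑ Z (λ p → l * M * 𝟙 (p ≤? K))   ≡⟨ ∑-*ˡ Z (l * M) _ ⟩
    l * M * ∑ Z (λ p → 𝟙 (p ≤? K))   ≤⟨ *-monoʳ-≤ (l * M) (∑-𝟙-≤? Z K) ⟩
    l * M * K                        ∎
  total≤ : ∀ p → total p ≤ ∑ M (λ m → val p (x m))
  total≤ p = ∑-mono-≤ M (λ m _ _ → ≤-trans (*-monoˡ-≤ (val p (x m)) (𝟙≤1 (prime? p))) (≤-reflexive (*-identityˡ _)))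
  h≡0 : ∀ p → total p ≤ error p → p * h p ≤ 2 * M
  h≡0 p t≤e rewrite m≤n⇒m∸n≡0 t≤e | *-zeroʳ p = z≤n
  p*h≤2M : ∀ p → p * h p ≤ 2 * M
  p*h≤2M p = case prime? p of λ where
      (no ¬pp) → h≡0 p (≤-trans (≤-reflexive (∑-zero M (λ m _ _ → cong (_* val p (x m)) (𝟙-no (prime? p) ¬pp)))) z≤n)
      (yes pp) → case p ∣? B of λ where
        (yes p∣B) → h≡0 p (begin
          total p                                ≤⟨ total≤ p ⟩
          ∑ M (λ m → val p (x m))                ≤⟨ ∑-mono-≤ M (λ m _ _ → ramified p pp p∣B m) ⟩
          ∑ M (λ _ → 𝟙 (p ≤? K) * l)             ≡⟨ trans (∑-const M _) (r′ M (𝟙 (p ≤? K)) l) ⟩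
          𝟙 (p ≤? K) * (l * M)                   ≤⟨ m≤n+m _ E ⟩
          error p                                ∎)
        (no p∤B) → let h′ , ph′≤2M , ∑≤ = ∑-val-progression pp p∤B M E size in
          ≤-trans (*-monoʳ-≤ p (begin
            total p ∸ error p  ≤⟨ ∸-mono (≤-trans (total≤ p) ∑≤) (m≤m+n E _) ⟩
            h′ + E ∸ E         ≡⟨ m+n∸n≡m h′ E ⟩
            h′                 ∎)) ph′≤2M
    where
    r′ : ∀ M c l → M * (c * l) ≡ c * (l * M)
    r′ = solve-∀

-- Simultaneous control of Ω and ω

solve-congruence : ∀ {K P} → Coprime K P → 0 < P → ∀ c → ∃[ a ] a < P × P ∣ K * a + c
solve-congruence {K} {P} K⊥P 0<P c = a % P , m%n<n a P ,
  ∣m+n∣m⇒∣n (subst (P ∣_) reduce P∣Ka+c) (∣n⇒∣m*n (K * (a / P)) ∣-refl)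
  where
  instance
    P≢0 : NonZero P
    P≢0 = >-nonZero 0<P
  solution : Bézout.Identity 1 K P → ∃[ a ] P ∣ K * a + c
  solution (Bézout.-+ x y eq) = c * x , divides (c * y) (begin
    K * (c * x) + c  ≡⟨ r K c x ⟩
    c * (1 + x * K)  ≡⟨ cong (c *_) eq ⟩
    c * (y * P)      ≡⟨ *-assoc c y P ⟨
    c * y * P        ∎)
    where
    open ≡-Reasoning
    r : ∀ K c x → K * (c * x) + c ≡ c * (1 + x * K)
    r = solve-∀
  -- Here `x` is an inverse of `K` modulo `P`, and `P ∸ 1` plays the role of -1; in the other case
  -- `x` already carries the sign.
  solution (Bézout.+- x y eq) = c * (x * (P ∸ 1)) , divides (c * (1 + y * (P ∸ 1))) (begin
    K * (c * (x * (P ∸ 1))) + c          ≡⟨ r₁ K c x (P ∸ 1) ⟩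
    c * (x * K * (P ∸ 1) + 1)            ≡⟨ cong (λ u → c * (u * (P ∸ 1) + 1)) eq ⟨
    c * ((1 + y * P) * (P ∸ 1) + 1)      ≡⟨ r₂ c y P (P ∸ 1) ⟩
    c * ((1 + (P ∸ 1)) + y * (P ∸ 1) * P) ≡⟨ cong (λ u → c * (u + y * (P ∸ 1) * P)) (m+[n∸m]≡n 0<P) ⟩
    c * (P + y * (P ∸ 1) * P)            ≡⟨ r₃ c y P (P ∸ 1) ⟩
    c * (1 + y * (P ∸ 1)) * P            ∎)
    where
    open ≡-Reasoning
    r₁ : ∀ K c x q → K * (c * (x * q)) + c ≡ c * (x * K * q + 1)
    r₁ = solve-∀
    r₂ : ∀ c y P q → c * ((1 + y * P) * q + 1) ≡ c * ((1 + q) + y * q * P)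
    r₂ = solve-∀
    r₃ : ∀ c y P q → c * (P + y * q * P) ≡ c * (1 + y * q) * P
    r₃ = solve-∀
  a : ℕ
  a = proj₁ (solution (coprime-Bézout K⊥P))
  P∣Ka+c : P ∣ K * a + c
  P∣Ka+c = proj₂ (solution (coprime-Bézout K⊥P))
  reduce : K * a + c ≡ K * (a / P) * P + (K * (a % P) + c)
  reduce = trans (cong (λ u → K * u + c) (m≡m%n+[m/n]*n a P)) (r K (a % P) (a / P) P c)
    where
    r : ∀ K u v P c → K * (u + v * P) + c ≡ K * v * P + (K * u + c)
    r = solve-∀

n<2^n : ∀ n → n < 2 ^ n
n<2^n zero    = s≤s z≤n
n<2^n (suc n) = ≤-trans (+-mono-≤ (m^n>0 2 n) (n<2^n n)) (+-monoʳ-≤ (2 ^ n) (m≤m+n _ 0))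

close-multiples : ∀ {p X i j} → i < j → j < p → p ∣ X + i → ¬ p ∣ X + j
close-multiples {p} {X} {i} {j} i<j j<p p∣Xi p∣Xj = <⇒≱ j<p (≤-trans
  (∣⇒≤ ⦃ >-nonZero (m<n⇒0<n∸m i<j) ⦄ (∣m+n∣m⇒∣n (subst (p ∣_) eq p∣Xj) p∣Xi)) (m∸n≤m j i))
  where
  eq : X + j ≡ X + i + (j ∸ i)
  eq = trans (cong (X +_) (sym (m+[n∸m]≡n (<⇒≤ i<j)))) (sym (+-assoc X i (j ∸ i)))

distinct-close-multiples : ∀ {p X i j} → i ≢ j → i < p → j < p → p ∣ X + i → ¬ p ∣ X + j
distinct-close-multiples {X = X} {i} {j} i≢j i<p j<p p∣Xi p∣Xj with <-≤-connex i j
... | inj₁ i<j = close-multiples {X = X} i<j j<p p∣Xi p∣Xj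
... | inj₂ j≤i = close-multiples {X = X} (≤∧≢⇒< j≤i (≢-sym i≢j)) i<p p∣Xj p∣Xi

∑χ≤ω : ∀ w N x → 1 ≤ x → ∏^ N (χ w) ∣ x → ∑ N (χ w) ≤ ω x
∑χ≤ω w N x 1≤x P∣x = begin
  ∑ N (χ w)                                     ≤⟨ ∑-mono-≤ N counted ⟩
  -- `ω x` counts only up to `x`, and `N` may be larger, but a prime beyond `x` cannot divide it.
  ∑ N g                                         ≤⟨ ∑-cutoff x N g ⟩
  ∑ x g + ∑ N (λ p → 𝟙 (x <? p) * g p)          ≡⟨ cong (∑ x g +_) (∑-zero N λ p _ _ → outside p) ⟩
  ∑ x g + 0                                     ≡⟨ +-identityʳ _ ⟩
  ∑ x g                                         ≡⟨ ω≡∑ x ⟨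
  ω x                                           ∎
  where
  open ≤-Reasoning
  g : ℕ → ℕ
  g p = 𝟙 (prime? p ×-dec (p ∣? x))
  counted : ∀ p → 1 ≤ p → p ≤ N → χ w p ≤ g p
  counted p 1≤p p≤N = 𝟙-mono (prime? p ×-dec (w <? p)) (prime? p ×-dec (p ∣? x))
    λ (pp , w<p) → pp , ∣-trans (χ-∣ w N p 1≤p p≤N (χ≡1 pp w<p)) P∣x
  outside : ∀ p → 𝟙 (x <? p) * g p ≡ 0
  outside p = case x <? p of λ where
    (no  x≮p) → cong (_* g p) (𝟙-no (x <? p) x≮p)
    (yes x<p) → trans (cong (𝟙 (x <? p) *_) (𝟙-no (prime? p ×-dec (p ∣? x))
                  λ (_ , p∣x) → <⇒≱ x<p (∣⇒≤ ⦃ >-nonZero 1≤x ⦄ p∣x))) (*-zeroʳ (𝟙 (x <? p)))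

module _ (k l R H i₀ : ℕ) (2≤k : 2 ≤ k) (R<2^l : R < 2 ^ l) (1≤i₀ : 1 ≤ i₀) (i₀≤R : i₀ ≤ R)
         (j N s T L : ℕ) (N≤2^j : N ≤ 2 ^ j) (∑χ≡T : ∑ N (χ (k ^ l + R)) ≡ T) where

  private
    instance
      k≢0 : NonZero k
      k≢0 = >-nonZero (≤-trans (s≤s z≤n) 2≤k)

    -- `E` bounds the binary length of all terms considered: `κ` covers the constants, `j * T` the
    -- modulus `P`, and `s + s` the length `M`. `V` bounds the average of Ω along one progression:
    -- `L` for the primes above 2^s, the rest for those up to 2^s.
    K w κ P M E V : ℕ
    K = k ^ l
    w = K + R
    κ = K + R + K
    P = ∏^ N (χ w)
    M = 2 ^ s * 2 ^ s
    E = κ + (j * T + (s + s))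
    V = L + (2 * suc s + (1 + K * l))

    0<P : 0 < P
    0<P = ∏^>0 N (χ w)

    0<K : 0 < K
    0<K = m^n>0 k l

    prime∣P⇒w< : ∀ {q} → Prime q → q ∣ P → w < q
    prime∣P⇒w< pq q∣P = proj₂ (χ≢0⇒ w _ (proj₂ (prime∣∏^⇒ pq N (χ w) (χ-supported w) q∣P)))

    K⊥P : Coprime K P
    K⊥P {d} (d∣K , d∣P) with d ≟ 1
    ... | yes d≡1 = d≡1
    ... | no  d≢1 =
      let 1≤d = n≢0⇒n>0 λ { refl → <⇒≢ 0<P (sym (0∣⇒≡0 d∣P)) }
          q , pq , q∣d = prime-divisor d (≤∧≢⇒< 1≤d (≢-sym d≢1))
      in contradiction (prime∣P⇒w< pq (∣-trans q∣d d∣P))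
           (≤⇒≯ (≤-trans (∣⇒≤ ⦃ >-nonZero 0<K ⦄ (∣-trans q∣d d∣K)) (m≤m+n K R)))

    congruence : ∃[ a ] a < P × P ∣ K * a + i₀
    congruence = solve-congruence K⊥P 0<P i₀

    a : ℕ
    a = proj₁ congruence

    -- K n + i at n = a + P m, written as a progression in `m` with difference `K * P`.
    x : ℕ → ℕ → ℕ
    x i m = K * a + i + K * P * m

    P≤2^jT : P ≤ 2 ^ (j * T)
    P≤2^jT = begin
      P                    ≤⟨ ∏^≤^∑ (2 ^ j) N (χ w) N≤2^j ⟩
      (2 ^ j) ^ ∑ N (χ w)  ≡⟨ cong ((2 ^ j) ^_) ∑χ≡T ⟩
      (2 ^ j) ^ T          ≡⟨ ^-*-assoc 2 j T ⟩
      2 ^ (j * T)          ∎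
      where open ≤-Reasoning

    x<2^E : ∀ i m → i ≤ R → m ≤ M → x i m < 2 ^ E
    x<2^E i m i≤R m≤M = begin-strict
      K * a + i + K * P * m
        ≤⟨ +-mono-≤ (+-mono-≤ (*-monoʳ-≤ K (<⇒≤ (proj₁ (proj₂ congruence)))) i≤R) (*-monoʳ-≤ (K * P) m≤M) ⟩
      K * P + R + K * P * M
        ≤⟨ +-monoˡ-≤ (K * P * M) (+-mono-≤
             (≤-trans (m≤m*n (K * P) M ⦃ M≢0 ⦄) (≤-reflexive (*-assoc K P M)))
             (m≤m*n R (P * M) ⦃ >-nonZero 0<PM ⦄)) ⟩
      K * (P * M) + R * (P * M) + K * P * M
        ≡⟨ r₁ K R P M ⟩
      κ * (P * M)
        <⟨ *-monoˡ-< (P * M) ⦃ >-nonZero 0<PM ⦄ (n<2^n κ) ⟩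
      2 ^ κ * (P * M)
        ≤⟨ *-monoʳ-≤ (2 ^ κ) (*-monoˡ-≤ M P≤2^jT) ⟩
      2 ^ κ * (2 ^ (j * T) * (2 ^ s * 2 ^ s))
        ≡⟨ cong (λ u → 2 ^ κ * (2 ^ (j * T) * u)) (^-distribˡ-+-* 2 s s) ⟨
      2 ^ κ * (2 ^ (j * T) * 2 ^ (s + s))
        ≡⟨ cong (2 ^ κ *_) (^-distribˡ-+-* 2 (j * T) (s + s)) ⟨
      2 ^ κ * 2 ^ (j * T + (s + s))
        ≡⟨ ^-distribˡ-+-* 2 κ _ ⟨
      2 ^ E ∎
      where
      open ≤-Reasoning
      0<M : 0 < M
      0<M = *-mono-≤ (m^n>0 2 s) (m^n>0 2 s)
      M≢0 : NonZero M
      M≢0 = >-nonZero 0<M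
      0<PM : 0 < P * M
      0<PM = *-mono-≤ 0<P 0<M
      r₁ : ∀ K R P M → K * (P * M) + R * (P * M) + K * P * M ≡ (K + R + K) * (P * M)
      r₁ = solve-∀

    P∣x : ∀ m → P ∣ x i₀ m
    P∣x m = ∣m∣n⇒∣m+n (proj₂ (proj₂ congruence)) (∣m⇒∣m*n m (∣n⇒∣m*n K ∣-refl))

    -- A prime dividing k has small valuation at x i m because i < 2^l, and a prime dividing P
    -- exceeds R, so it cannot divide both x i m and x i₀ m.
    ramified : ∀ i → 1 ≤ i → i ≤ R → i ≢ i₀ → ∀ p → Prime p → p ∣ K * P →
      ∀ m → val p (x i m) ≤ 𝟙 (p ≤? K) * l
    ramified i 1≤i i≤R i≢i₀ p pp p∣KP m with euclidsLemma K P pp p∣KP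
    ... | inj₁ p∣K = subst (λ c → val p (x i m) ≤ c * l)
          (sym (𝟙-yes (p ≤? K) (∣⇒≤ ⦃ >-nonZero 0<K ⦄ p∣K)))
          (≤-trans (<⇒≤ (∤⇒val< p (x i m) l p^l∤x)) (≤-reflexive (sym (*-identityˡ l))))
      where
      p^l∣K : p ^ l ∣ K
      p^l∣K = ^-monoˡ-∣ l (prime∣^⇒∣ pp k l p∣K)
        where
        ^-monoˡ-∣ : ∀ {a b} n → a ∣ b → a ^ n ∣ b ^ n
        ^-monoˡ-∣ zero    a∣b = ∣-refl
        ^-monoˡ-∣ {a} {b} (suc n) a∣b = *-pres-∣ {a} {b} {a ^ n} {b ^ n} a∣b (^-monoˡ-∣ n a∣b)
      p^l∤x : ¬ p ^ l ∣ x i m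
      p^l∤x d = <⇒≱ (≤-trans (s≤s i≤R) (≤-trans R<2^l (^-monoˡ-≤ l (prime>1 pp))))
        (∣⇒≤ ⦃ >-nonZero 1≤i ⦄ (∣m+n∣m⇒∣n (subst (p ^ l ∣_) (r K a i P m) d) (∣m⇒∣m*n (a + P * m) p^l∣K)))
        where
        r : ∀ K a i P m → K * a + i + K * P * m ≡ K * (a + P * m) + i
        r = solve-∀
    ... | inj₂ p∣P = ≤-trans (s≤s⁻¹ (∤⇒val< p (x i m) 1
            (λ d → distinct-close-multiples {X = K * a + K * P * m} i≢i₀ (R<p i≤R) (R<p i₀≤R)
              (subst (p ∣_) (r K a i P m) (subst (_∣ x i m) (^-identityʳ p) d))
              (subst (p ∣_) (r K a i₀ P m) (∣-trans p∣P (P∣x m)))))) z≤n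
      where
      R<p : ∀ {i} → i ≤ R → i < p
      R<p i≤R = ≤-trans (s≤s (≤-trans i≤R (m≤n+m R K))) (prime∣P⇒w< pp p∣P)
      r : ∀ K a i P m → K * a + i + K * P * m ≡ K * a + K * P * m + i
      r = solve-∀

    -- The value 0 removes the distinguished shift from sums over all shifts.
    other : ℕ → ℕ → ℕ
    other i m with i ≟ i₀
    ... | yes _ = 0
    ... | no  _ = Ω (x i m)

    other-≢ : ∀ i m → i ≢ i₀ → other i m ≡ Ω (x i m)
    other-≢ i m i≢i₀ with i ≟ i₀
    ... | yes i≡i₀ = contradiction i≡i₀ i≢i₀
    ... | no  _    = refl

    ∑other≤ : E ≤ s * L → 2 ^ s * E ≤ M → ∀ i → 1 ≤ i → i ≤ R → ∑ M (other i) ≤ M * V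
    ∑other≤ E≤sL 2^s*E≤M i 1≤i i≤R with i ≟ i₀
    ... | yes _    = ≤-trans (≤-reflexive (∑-zero M λ _ _ _ → refl)) z≤n
    ... | no  i≢i₀ = ∑-Ω-progression (K * a + i) (K * P) M E s L K l
      (λ m _ m≤M → ≤-trans (≤-trans 1≤i (m≤n+m i (K * a))) (m≤m+n (K * a + i) _) , x<2^E i m i≤R m≤M)
      (ramified i 1≤i i≤R i≢i₀) 2^s*E≤M E≤sL

    -- Averaging the sum over all shifts, instead of each shift separately, gives one `m` that is
    -- good for all of them.
    average : E ≤ s * L → 2 ^ s * E ≤ M → ∃[ m ] 1 ≤ m × ∑ R (λ i → other i m) ≤ R * V
    average E≤sL 2^s*E≤M = pigeonhole M (*-mono-≤ (m^n>0 2 s) (m^n>0 2 s)) (begin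
      ∑ M (λ m → ∑ R (λ i → other i m)) ≡⟨ ∑-swap M R (λ m i → other i m) ⟩
      ∑ R (λ i → ∑ M (other i))         ≤⟨ ∑-mono-≤ R (∑other≤ E≤sL 2^s*E≤M) ⟩
      ∑ R (λ _ → M * V)                 ≡⟨ trans (∑-const R (M * V)) (r R M V) ⟩
      M * (R * V)                       ∎)
      where
      open ≤-Reasoning
      r : ∀ R M V → R * (M * V) ≡ M * (R * V)
      r = solve-∀
      pigeonhole : ∀ M → 0 < M → ∑ M (λ m → ∑ R (λ i → other i m)) ≤ M * (R * V) →
        ∃[ m ] 1 ≤ m × ∑ R (λ i → other i m) ≤ R * V
      pigeonhole (suc M) _ = ∑-pigeonhole M (R * V) _

  -- At n = a + P m all `T` primes of `P` divide the distinguished term, while the other values of Ω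
  -- add up to at most R V, and H R V < T.
  dominated-by-parameters : k ^ l + R + k ^ l + (j * T + (s + s)) ≤ s * L →
    2 ^ s * (k ^ l + R + k ^ l + (j * T + (s + s))) ≤ 2 ^ s * 2 ^ s →
    suc (H * R) * (L + (2 * suc s + (1 + k ^ l * l))) < T →
    ∃[ n ] 1 ≤ n × (∀ i → 1 ≤ i → i ≤ R → i ≢ i₀ → H * Ω (k ^ l * n + i) < ω (k ^ l * n + i₀))
  dominated-by-parameters E≤sL 2^s*E≤M GV<T with m , 1≤m , ∑≤ ← average E≤sL 2^s*E≤M =
    a + P * m , ≤-trans (*-mono-≤ 0<P 1≤m) (m≤n+m _ a) , λ i 1≤i i≤R i≢i₀ → begin-strict
      H * Ω (K * (a + P * m) + i)        ≡⟨ cong (λ u → H * Ω u) (r K a i P m) ⟩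
      H * Ω (x i m)                      ≡⟨ cong (H *_) (other-≢ i m i≢i₀) ⟨
      H * other i m                      ≤⟨ *-monoʳ-≤ H (term≤∑ (λ i → other i m) 1≤i i≤R) ⟩
      H * ∑ R (λ i → other i m)          ≤⟨ *-monoʳ-≤ H ∑≤ ⟩
      H * (R * V)                        ≡⟨ *-assoc H R V ⟨
      H * R * V                          ≤⟨ m≤n+m _ V ⟩
      suc (H * R) * V                    <⟨ GV<T ⟩
      T                                  ≡⟨ ∑χ≡T ⟨
      ∑ N (χ w)                          ≤⟨ ∑χ≤ω w N (x i₀ m)
                                              (≤-trans (≤-trans 1≤i₀ (m≤n+m i₀ (K * a))) (m≤m+n (K * a + i₀) _)) (P∣x m) ⟩
      ω (x i₀ m)                         ≡⟨ cong ω (r K a i₀ P m) ⟨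
      ω (K * (a + P * m) + i₀)           ∎
    where
    open ≤-Reasoning
    r : ∀ K a i P m → K * (a + P * m) + i ≡ K * a + i + K * P * m
    r = solve-∀

-- Choice of the parameters

parameter-inequalities : ∀ G κ u s j T → 1 ≤ G → 8 ≤ s → κ + (5 + u) < s →
  j * T ≡ 2 * (s * s) → G * (8 * s) ≡ T → let L = κ + (2 * s + 2); E = κ + (j * T + (s + s)) in
  E ≤ s * L × E ≤ 2 ^ s × G * (L + (2 * suc s + (1 + u))) < T
parameter-inequalities G κ u s j T 1≤G 8≤s C<s jT≡2s² G8s≡T = E≤sL , E≤2^s , GV<T
  where
  open ≤-Reasoning
  E≤sL : κ + (j * T + (s + s)) ≤ s * (κ + (2 * s + 2))
  E≤sL = begin
    κ + (j * T + (s + s))           ≡⟨ cong (λ v → κ + (v + (s + s))) jT≡2s² ⟩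
    κ + (2 * (s * s) + (s + s))     ≤⟨ +-monoˡ-≤ _ (m≤n*m κ s ⦃ >-nonZero (≤-trans (s≤s z≤n) 8≤s) ⦄) ⟩
    s * κ + (2 * (s * s) + (s + s)) ≡⟨ r s κ ⟩
    s * (κ + (2 * s + 2))           ∎
    where
    r : ∀ s κ → s * κ + (2 * (s * s) + (s + s)) ≡ s * (κ + (2 * s + 2))
    r = solve-∀
  E≤2^s : κ + (j * T + (s + s)) ≤ 2 ^ s
  E≤2^s = begin
    κ + (j * T + (s + s))           ≡⟨ cong (λ v → κ + (v + (s + s))) jT≡2s² ⟩
    κ + (2 * (s * s) + (s + s))     ≤⟨ +-monoˡ-≤ _ (≤-trans (m≤m+n κ (5 + u)) (<⇒≤ C<s)) ⟩
    s + (2 * (s * s) + (s + s))     ≡⟨ r s ⟩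
    2 * (s * s) + 3 * s             ≤⟨ quadratic≤2^ s 8≤s ⟩
    2 ^ s                           ∎
    where
    r : ∀ s → s + (2 * (s * s) + (s + s)) ≡ 2 * (s * s) + 3 * s
    r = solve-∀
  -- `L` contributes 2s, the small primes another 2s, and the constants less than s: below 5s in
  -- all, against T/G = 8s.
  GV<T : G * (κ + (2 * s + 2) + (2 * suc s + (1 + u))) < T
  GV<T = begin-strict
    G * (κ + (2 * s + 2) + (2 * suc s + (1 + u))) ≡⟨ cong (G *_) (r₁ κ s u) ⟩
    G * (κ + (5 + u) + 4 * s)  <⟨ *-monoʳ-< G ⦃ >-nonZero 1≤G ⦄ (+-monoˡ-< (4 * s) C<s) ⟩
    G * (s + 4 * s)            ≤⟨ *-monoʳ-≤ G (m≤m+n (s + 4 * s) (3 * s)) ⟩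
    G * (s + 4 * s + 3 * s)    ≡⟨ cong (G *_) (r₂ s) ⟩
    G * (8 * s)                ≡⟨ G8s≡T ⟩
    T                          ∎
    where
    r₁ : ∀ κ s u → κ + (2 * s + 2) + (2 * suc s + (1 + u)) ≡ κ + (5 + u) + 4 * s
    r₁ = solve-∀
    r₂ : ∀ s → s + 4 * s + 3 * s ≡ 8 * s
    r₂ = solve-∀

-- For T = 32G²j, the choice s = 4Gj gives jT = 2s² and T = 8Gs. The first makes E/s at most 2s + 2
-- + κ, the value taken for `L`; the threshold on `j` passes to `s` since j ≤ s.
choose-parameters : ∀ G κ u j → 1 ≤ G → 8 + suc (κ + (5 + u)) ≤ j →
  ∃[ s ] ∃[ L ] let E = κ + (j * (32 * (G * G) * j) + (s + s)) in
  E ≤ s * L × E ≤ 2 ^ s × G * (L + (2 * suc s + (1 + u))) < 32 * (G * G) * j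
choose-parameters G κ u j 1≤G j-large = 4 * (G * j) , κ + (2 * (4 * (G * j)) + 2) ,
  parameter-inequalities G κ u (4 * (G * j)) j (32 * (G * G) * j) 1≤G
    (≤-trans (m≤m+n 8 (suc (κ + (5 + u)))) (≤-trans j-large j≤s))
    (≤-trans (m≤n+m (suc (κ + (5 + u))) 8) (≤-trans j-large j≤s))
    (r₁ G j) (r₂ G j)
  where
  j≤s : j ≤ 4 * (G * j)
  j≤s = ≤-trans (m≤n*m j G ⦃ >-nonZero 1≤G ⦄) (m≤n*m (G * j) 4)
  r₁ : ∀ G j → j * (32 * (G * G) * j) ≡ 2 * (4 * (G * j) * (4 * (G * j)))
  r₁ = solve-∀
  r₂ : ∀ G j → G * (8 * (4 * (G * j))) ≡ 32 * (G * G) * j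
  r₂ = solve-∀

-- The number of selected primes is prescribed exactly: it must be large to make ω large, and
-- bounded to keep `P`, and with it the length of the terms, under control.
dominant-prime-count : ∀ k l R H i₀ → 2 ≤ k → R < 2 ^ l → 1 ≤ i₀ → i₀ ≤ R →
  ∃[ n ] 1 ≤ n × (∀ i → 1 ≤ i → i ≤ R → i ≢ i₀ → H * Ω (k ^ l * n + i) < ω (k ^ l * n + i₀))
dominant-prime-count k l R H i₀ 2≤k R<2^l 1≤i₀ i₀≤R =
  finish (prime-supply (k ^ l + R) (32 * (G * G)) (8 + suc (κ + (5 + k ^ l * l))))
  where
  G κ : ℕ
  -- The successor makes `G` positive, as `choose-parameters` requires.
  G = suc (H * R)
  κ = k ^ l + R + k ^ l
  Goal : Set
  Goal = ∃[ n ] 1 ≤ n × (∀ i → 1 ≤ i → i ≤ R → i ≢ i₀ → H * Ω (k ^ l * n + i) < ω (k ^ l * n + i₀))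
  finish : (∃[ j ] 8 + suc (κ + (5 + k ^ l * l)) ≤ j ×
            ∃[ N ] N ≤ 2 ^ j × ∑ N (χ (k ^ l + R)) ≡ 32 * (G * G) * j) → Goal
  finish (j , j-large , N , N≤2^j , ∑χ≡T) =
    let s , L , E≤sL , E≤2^s , GV<T = choose-parameters G κ (k ^ l * l) j (s≤s z≤n) j-large in
    dominated-by-parameters k l R H i₀ 2≤k R<2^l 1≤i₀ i₀≤R j N s (32 * (G * G) * j) L N≤2^j ∑χ≡T
      E≤sL (*-monoʳ-≤ (2 ^ s) E≤2^s) GV<T

-- Linear dependence

open import Data.Integer using (+_)

linComb-linear : ∀ d a b (c e : Fin d → ℤ) f m →
  linComb d (λ j → a ℤ.* c j ℤ.- b ℤ.* e j) f m ≡ a ℤ.* linComb d c f m ℤ.- b ℤ.* linComb d e f m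
linComb-linear zero    a b c e f m = r a b
  where
  r : ∀ a b → 0ℤ ≡ a ℤ.* 0ℤ ℤ.- b ℤ.* 0ℤ
  r = ℤ-Solver.solve-∀
linComb-linear (suc d) a b c e f m =
  trans (cong (λ u → (a ℤ.* c zero ℤ.- b ℤ.* e zero) ℤ.* f zero m ℤ.+ u)
          (linComb-linear d a b (c ∘ suc) (e ∘ suc) (f ∘ suc) m))
        (r a b (c zero) (e zero) (f zero m) (linComb d (c ∘ suc) (f ∘ suc) m) (linComb d (e ∘ suc) (f ∘ suc) m))
  where
  r : ∀ a b c e x u v → (a ℤ.* c ℤ.- b ℤ.* e) ℤ.* x ℤ.+ (a ℤ.* u ℤ.- b ℤ.* v)
    ≡ a ℤ.* (c ℤ.* x ℤ.+ u) ℤ.- b ℤ.* (e ℤ.* x ℤ.+ v)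
  r = ℤ-Solver.solve-∀

LinearlyDependent : ∀ {n} → (Fin n → ℕ → ℤ) → Set
LinearlyDependent {n} v =
  Σ (Fin n → ℤ) λ y → (∃[ i ] y i ≢ 0ℤ) × (∀ m → ℤ-sum (λ i → y i ℤ.* v i m) ≡ 0ℤ)

-- A relation `y` among the reduced vectors lifts with coefficients α yᵢ and, at the pivot, -∑ yᵢ
-- βᵢ. It stays nontrivial because ℤ has no zero divisors.
dependent-via-pivot : ∀ {n} (v : Fin (suc n) → ℕ → ℤ) p α (β : Fin n → ℤ) → α ≢ 0ℤ →
  LinearlyDependent (λ i m → α ℤ.* v (punchIn p i) m ℤ.- β i ℤ.* v p m) → LinearlyDependent v
dependent-via-pivot {n} v p α β α≢0 (y , (i , yᵢ≢0) , y-rel) = z , (punchIn p i , zᵢ≢0) , z-rel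
  where
  open ≡-Reasoning
  zₚ : ℤ
  zₚ = ℤ-sum (λ i → y i ℤ.* (ℤ.- β i))
  z : Fin (suc n) → ℤ
  z = insertAt (λ i → α ℤ.* y i) p zₚ
  zᵢ≢0 : z (punchIn p i) ≢ 0ℤ
  zᵢ≢0 eq with ℤ.i*j≡0⇒i≡0∨j≡0 α (trans (sym (insertAt-punchIn (λ i → α ℤ.* y i) p zₚ i)) eq)
  ... | inj₁ α≡0  = α≢0 α≡0
  ... | inj₂ yᵢ≡0 = yᵢ≢0 yᵢ≡0
  z-rel : ∀ m → ℤ-sum (λ i → z i ℤ.* v i m) ≡ 0ℤ
  z-rel m = begin
    ℤ-sum (λ i → z i ℤ.* v i m)
      ≡⟨ sum-remove {i = p} (λ i → z i ℤ.* v i m) ⟩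
    z p ℤ.* v p m ℤ.+ ℤ-sum (λ i → z (punchIn p i) ℤ.* v (punchIn p i) m)
      ≡⟨ cong₂ ℤ._+_
           (trans (cong (ℤ._* v p m) (insertAt-lookup (λ i → α ℤ.* y i) p zₚ))
             (trans (ℤ.*-comm zₚ (v p m)) (ℤ-*-distribˡ-sum (v p m) (λ i → y i ℤ.* (ℤ.- β i)))))
           (sum-cong-≗ (λ i → cong (ℤ._* v (punchIn p i) m) (insertAt-punchIn (λ i → α ℤ.* y i) p zₚ i))) ⟩
    ℤ-sum (λ i → v p m ℤ.* (y i ℤ.* (ℤ.- β i))) ℤ.+ ℤ-sum (λ i → α ℤ.* y i ℤ.* v (punchIn p i) m)
      ≡⟨ ∑-distrib-+ (λ i → v p m ℤ.* (y i ℤ.* (ℤ.- β i))) (λ i → α ℤ.* y i ℤ.* v (punchIn p i) m) ⟨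
    ℤ-sum (λ i → v p m ℤ.* (y i ℤ.* (ℤ.- β i)) ℤ.+ α ℤ.* y i ℤ.* v (punchIn p i) m)
      ≡⟨ sum-cong-≗ (λ i → r (v p m) (y i) (β i) α (v (punchIn p i) m)) ⟩
    ℤ-sum (λ i → y i ℤ.* (α ℤ.* v (punchIn p i) m ℤ.- β i ℤ.* v p m))
      ≡⟨ y-rel m ⟩
    0ℤ ∎
    where
    r : ∀ x y β α u → x ℤ.* (y ℤ.* (ℤ.- β)) ℤ.+ α ℤ.* y ℤ.* u ≡ y ℤ.* (α ℤ.* u ℤ.- β ℤ.* x)
    r = ℤ-Solver.solve-∀

-- Fraction-free Gaussian elimination: cross-multiplying with a pivot removes one spanning sequence
-- and one vector without leaving ℤ.
span⇒dependent : ∀ d (f : Fin d → ℕ → ℤ) (v : Fin (suc d) → ℕ → ℤ) (c : Fin (suc d) → Fin d → ℤ) →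
  (∀ i m → v i m ≡ linComb d (c i) f m) → LinearlyDependent v
span⇒dependent zero f v c v≡ =
  (λ _ → 1ℤ) , (zero , λ ()) , λ m → cong (λ u → 1ℤ ℤ.* u ℤ.+ 0ℤ) (v≡ zero m)
span⇒dependent (suc d) f v c v≡ = case any? (λ i → ¬? (c i zero ℤ.≟ 0ℤ)) of λ where
    (yes (p , α≢0)) → eliminate p (c p zero) α≢0 λ i → ℤ.*-comm (c p zero) (c (punchIn p i) zero)
    -- No vector involves the first spanning sequence, so all βᵢ vanish and the pivot is merely
    -- discarded.
    (no  c≡0)       → eliminate zero 1ℤ (λ ()) λ i →
      let cᵢ≡0 = decidable-stable (c (suc i) zero ℤ.≟ 0ℤ) (λ ≢0 → c≡0 (suc i , ≢0)) in
      trans (cong (1ℤ ℤ.*_) cᵢ≡0) (cong (ℤ._* c zero zero) (sym cᵢ≡0))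
  where
  eliminate : ∀ p α → α ≢ 0ℤ →
    (∀ i → α ℤ.* c (punchIn p i) zero ≡ c (punchIn p i) zero ℤ.* c p zero) → LinearlyDependent v
  eliminate p α α≢0 αβ≡βγ = dependent-via-pivot v p α β α≢0
    (span⇒dependent d (f ∘ suc) _ (λ i j → α ℤ.* c (punchIn p i) (suc j) ℤ.- β i ℤ.* c p (suc j)) λ i m → begin
      α ℤ.* v (punchIn p i) m ℤ.- β i ℤ.* v p m
        ≡⟨ cong₂ (λ x y → α ℤ.* x ℤ.- β i ℤ.* y) (v≡ (punchIn p i) m) (v≡ p m) ⟩
      α ℤ.* (β i ℤ.* f zero m ℤ.+ rest (punchIn p i) m) ℤ.- β i ℤ.* (c p zero ℤ.* f zero m ℤ.+ rest p m)
        ≡⟨ r₁ α (β i) (f zero m) (rest (punchIn p i) m) (c p zero) (rest p m) ⟩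
      (α ℤ.* β i ℤ.- β i ℤ.* c p zero) ℤ.* f zero m ℤ.+ (α ℤ.* rest (punchIn p i) m ℤ.- β i ℤ.* rest p m)
        ≡⟨ cong (λ u → u ℤ.* f zero m ℤ.+ (α ℤ.* rest (punchIn p i) m ℤ.- β i ℤ.* rest p m))
             (ℤ.i≡j⇒i-j≡0 (αβ≡βγ i)) ⟩
      0ℤ ℤ.* f zero m ℤ.+ (α ℤ.* rest (punchIn p i) m ℤ.- β i ℤ.* rest p m)
        ≡⟨ r₂ (f zero m) (α ℤ.* rest (punchIn p i) m ℤ.- β i ℤ.* rest p m) ⟩
      α ℤ.* rest (punchIn p i) m ℤ.- β i ℤ.* rest p m
        ≡⟨ linComb-linear d α (β i) (c (punchIn p i) ∘ suc) (c p ∘ suc) (f ∘ suc) m ⟨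
      linComb d (λ j → α ℤ.* c (punchIn p i) (suc j) ℤ.- β i ℤ.* c p (suc j)) (f ∘ suc) m ∎)
    where
    open ≡-Reasoning
    β : Fin (suc d) → ℤ
    β i = c (punchIn p i) zero
    rest : Fin (suc (suc d)) → ℕ → ℤ
    rest i m = linComb d (c i ∘ suc) (f ∘ suc) m
    r₁ : ∀ α β x u γ w → α ℤ.* (β ℤ.* x ℤ.+ u) ℤ.- β ℤ.* (γ ℤ.* x ℤ.+ w)
       ≡ (α ℤ.* β ℤ.- β ℤ.* γ) ℤ.* x ℤ.+ (α ℤ.* u ℤ.- β ℤ.* w)
    r₁ = ℤ-Solver.solve-∀
    r₂ : ∀ x u → 0ℤ ℤ.* x ℤ.+ u ≡ u
    r₂ = ℤ-Solver.solve-∀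

-- From a dominant term to non-regularity

∣sum∣≤ : ∀ {n} (g : Fin n → ℤ) → ∣ ℤ-sum g ∣ ≤ ℕ-sum (λ i → ∣ g i ∣)
∣sum∣≤ {zero}  g = z≤n
∣sum∣≤ {suc n} g = ≤-trans (ℤ.∣i+j∣≤∣i∣+∣j∣ (g zero) _) (+-monoʳ-≤ ∣ g zero ∣ (∣sum∣≤ (g ∘ suc)))

ℕ-sum-mono-≤ : ∀ {n} {f g : Fin n → ℕ} → (∀ i → f i ≤ g i) → ℕ-sum f ≤ ℕ-sum g
ℕ-sum-mono-≤ {zero}  f≤g = z≤n
ℕ-sum-mono-≤ {suc n} f≤g = +-mono-≤ (f≤g zero) (ℕ-sum-mono-≤ (f≤g ∘ suc))

-- A vanishing sum would bound `u p` by the sum of the other terms in absolute value. Multiplied by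
-- `suc Y`, this gives `suc Y * u p ≤ Y * u p`, against `0 < u p`.
dominant-term-≢0 : ∀ {n} (y : Fin (suc n) → ℤ) (u : Fin (suc n) → ℕ) p → y p ≢ 0ℤ → 0 < u p →
  (∀ i → suc (ℕ-sum (λ j → ∣ y (punchIn p j) ∣)) * u (punchIn p i) ≤ u p) →
  ℤ-sum (λ i → y i ℤ.* + u i) ≢ 0ℤ
dominant-term-≢0 {n} y u p yₚ≢0 0<uₚ dominates sum≡0 = <-irrefl refl (begin-strict
  Y * u p                          <⟨ m<n+m (Y * u p) 0<uₚ ⟩
  H * u p                          ≤⟨ *-monoʳ-≤ H uₚ≤ ⟩
  H * ℕ-sum (λ j → a j * t j)      ≡⟨ ℕ-*-distribˡ-sum H (λ j → a j * t j) ⟩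
  ℕ-sum (λ j → H * (a j * t j))    ≤⟨ ℕ-sum-mono-≤ (λ j → 
                                       ≤-trans (≤-reflexive (r H (a j) (t j))) (*-monoʳ-≤ (a j) (dominates j))) ⟩
  ℕ-sum (λ j → a j * u p)          ≡⟨ ℕ-*-distribʳ-sum (u p) a ⟨
  Y * u p                          ∎)
  where
  open ≤-Reasoning
  a t : Fin n → ℕ
  a j = ∣ y (punchIn p j) ∣
  t j = u (punchIn p j)
  Y H : ℕ
  Y = ℕ-sum a
  H = suc Y
  r : ∀ H a t → H * (a * t) ≡ a * (H * t)
  r = solve-∀
  others : Fin n → ℤ
  others j = y (punchIn p j) ℤ.* + u (punchIn p j)
  yₚuₚ≡ : y p ℤ.* + u p ≡ ℤ.- ℤ-sum others
  yₚuₚ≡ = inverseˡ-unique _ (ℤ-sum others) (trans (sym (sum-remove {i = p} (λ i → y i ℤ.* + u i))) sum≡0)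
  uₚ≤ : u p ≤ ℕ-sum (λ j → a j * t j)
  uₚ≤ = begin
    u p                             ≤⟨ m≤n*m (u p) ∣ y p ∣ ⦃ ≢-nonZero (yₚ≢0 ∘ ℤ.∣i∣≡0⇒i≡0) ⦄ ⟩
    ∣ y p ∣ * u p                   ≡⟨ ℤ.abs-* (y p) (+ u p) ⟨
    ∣ y p ℤ.* + u p ∣               ≡⟨ cong ∣_∣ yₚuₚ≡ ⟩
    ∣ ℤ.- ℤ-sum others ∣            ≡⟨ ℤ.∣-i∣≡∣i∣ (ℤ-sum others) ⟩
    ∣ ℤ-sum others ∣                ≤⟨ ∣sum∣≤ others ⟩
    ℕ-sum (λ j → ∣ others j ∣)      ≤⟨ ℕ-sum-mono-≤ (λ j →
                                         ≤-reflexive (ℤ.abs-* (y (punchIn p j)) (+ u (punchIn p j)))) ⟩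
    ℕ-sum (λ j → a j * t j)         ∎

-- The dominance estimate has ω on its large side and Ω on its small side, so a single argument
-- serves every sequence between them, both ends included.
between-ω-Ω⇒¬regular : ∀ (t : ℕ → ℕ) → (∀ n → ω n ≤ t n) → (∀ n → t n ≤ Ω n) →
  ∀ k → 2 ≤ k → ¬ IsRegular k (λ n → + t n)
between-ω-Ω⇒¬regular t ω≤t t≤Ω k 2≤k (d , f , spans) =
  -- The extra index R = d + 2 makes the dominant term positive even when d = 0.
  contradict (2 + d) (2 + d) (n<2^n (2 + d)) ≤-refl
  where
  index : Fin (suc d) → ℕ
  -- Shifts start at 1: the bound on valuations at primes dividing `k` rests on `0 < i < 2 ^ l`.
  index i = suc (toℕ i)
  contradict : ∀ l R → R < 2 ^ l → suc d < R → ⊥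
  contradict l R R<2^l d<R = no-relation
    (span⇒dependent d f v (λ i → proj₁ (spans l (index i) (index<k^l i)))
      (λ i → proj₂ (spans l (index i) (index<k^l i))))
    where
    index<R : ∀ i → index i < R
    index<R i = ≤-trans (s≤s (toℕ<n i)) d<R
    index<k^l : ∀ i → index i < k ^ l
    index<k^l i = <-trans (index<R i) (≤-trans R<2^l (^-monoˡ-≤ l 2≤k))
    v : Fin (suc d) → ℕ → ℤ
    v i = kernelSeq k (λ n → + t n) l (index i)
    no-relation : ¬ LinearlyDependent v
    no-relation (y , (p , yₚ≢0) , y-rel) =
      refute (dominant-prime-count k l R H (index p) 2≤k R<2^l (s≤s z≤n) (<⇒≤ (index<R p)))
      where
      H : ℕ
      H = suc (ℕ-sum (λ j → ∣ y (punchIn p j) ∣))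
      refute : ¬ (∃[ n ] 1 ≤ n × (∀ i → 1 ≤ i → i ≤ R → i ≢ index p →
                    H * Ω (k ^ l * n + i) < ω (k ^ l * n + index p)))
      refute (suc m , _ , dominated) =
        dominant-term-≢0 y (t ∘ x) p yₚ≢0
          (≤-trans (m<n⇒0<n (dominated R (m<n⇒0<n d<R) ≤-refl (≢-sym (<⇒≢ (index<R p))))) (ω≤t (x p)))
          (λ i → ≤-trans (*-monoʳ-≤ H (t≤Ω (x (punchIn p i)))) (≤-trans (<⇒≤
            (dominated (index (punchIn p i)) (s≤s z≤n) (<⇒≤ (index<R (punchIn p i)))
              (λ eq → punchInᵢ≢i p i (toℕ-injective (suc-injective eq))))) (ω≤t (x p))))
          (y-rel m)
        where
        x : Fin (suc d) → ℕ
        x i = k ^ l * suc m + index i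

theorem3p5 : (k : ℕ) → k ≥ 2 → ¬ IsRegular k ωSeq × ¬ IsRegular k ΩSeq
theorem3p5 k k≥2 = between-ω-Ω⇒¬regular ω (λ _ → ≤-refl) ω≤Ω k k≥2
                 , between-ω-Ω⇒¬regular Ω ω≤Ω (λ _ → ≤-refl) k k≥2
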